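{- For integers $n,k>0$, $$(-1)^{k-1}\left(\sum_{j=0}^{2k-1}(-1)^{j(j+1)/2}\,\sigma\,\mathrm{mex}\big(n-j(j+1)/2\big)-D_2^*(n)\right)=\sum_{j=0}^{n}MP_k(j)\,D_2^*(n-j).$$
   Context: For a partition $\lambda$, $\mathrm{mex}(\lambda)$ is the smallest positive integer that is not a part of $\lambda$ (the empty partition has mex $1$). For an integer $m\geqslant 0$, $\sigma\,\mathrm{mex}(m)$ is the sum of $\mathrm{mex}(\lambda)$ over all partitions $\lambda$ of $m$; $\sigma\,\mathrm{mex}(m)=0$ for $m<0$. $D_2^*(m)$ is the number of partitions of $m$ into distinct parts using two colors $0$ and $1$ (no colored part repeated) such that the parts of color $0$ are exactly $1,2,\dots,j$ for some $j\geqslant 0$ and only even parts can have color $1$. $MP_k(m)$ is the number of partitions of $m$ in which the first (smallest) part larger than $2k-1$ (which must exist) is odd and appears exactly $k$ times, and all other odd parts appear at most once. -}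

module Defs where

open import Data.Nat using (ℕ; zero; suc; _+_; _*_; _∸_; _≤ᵇ_; _≡ᵇ_; _<ᵇ_)
open import Data.Nat.Base using (_/_)
open import Data.Bool using (Bool; true; false; _∧_; _∨_; not; if_then_else_)
open import Data.Nat.ListAction using (sum)
open import Data.List using (List; []; _∷_; map; filter; length; concatMap; upTo; foldr; _++_; cartesianProduct)
open import Data.Integer using (ℤ; +_; -_) renaming (_+_ to _+ℤ_)
open import Data.Product using (_×_; _,_; proj₁; proj₂)
open import Relation.Nullary.Decidable using (Dec; yes; no)
open import Relation.Binary.PropositionalEquality using (_≡_; refl)
open import Data.Bool.Properties using () renaming (_≟_ to _≟B_)

-- Partitions are represented as weakly decreasing lists of positive
-- integers (largest part first).

-- gen fuel m b : all weakly decreasing lists of positive integers with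
-- every part ≤ b and sum m (each exactly once), provided fuel ≥ m
gen : (fuel m b : ℕ) → List (List ℕ)
gen fuel    zero    b = [] ∷ []
gen zero    (suc m) b = []
gen (suc f) (suc m) b =
  concatMap (λ p → if p ≤ᵇ b then map (p ∷_) (gen f (suc m ∸ p) p) else [])
            (map suc (upTo (suc m)))

allPos : List ℕ → Bool
allPos []       = true
allPos (x ∷ xs) = (1 ≤ᵇ x) ∧ allPos xs

nonIncr : List ℕ → Bool
nonIncr []           = true
nonIncr (x ∷ [])     = true
nonIncr (x ∷ y ∷ xs) = (y ≤ᵇ x) ∧ nonIncr (y ∷ xs)

strictDecr : List ℕ → Bool
strictDecr []           = true
strictDecr (x ∷ [])     = true
strictDecr (x ∷ y ∷ xs) = (y <ᵇ x) ∧ strictDecr (y ∷ xs)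

isPartitionOf : ℕ → List ℕ → Bool
isPartitionOf m l = allPos l ∧ nonIncr l ∧ (sum l ≡ᵇ m)


filterB : {A : Set} → (A → Bool) → List A → List A
filterB p []       = []
filterB p (x ∷ xs) = if p x then x ∷ filterB p xs else filterB p xs

-- the list of all partitions of m (each exactly once): a partition of m
-- (the filter is redundant but makes soundness evident)
partitions : ℕ → List (List ℕ)
partitions m = filterB (isPartitionOf m) (gen m m m)

count : {A : Set} → (A → Bool) → List A → ℕ
count p xs = length (filterB p xs)

elemB : ℕ → List ℕ → Bool
elemB x []       = false
elemB x (y ∷ ys) = (x ≡ᵇ y) ∨ elemB x ys

mexFrom : List ℕ → (fuel start : ℕ) → ℕ
mexFrom l zero       i = i
mexFrom l (suc fuel) i = if elemB i l then mexFrom l fuel (suc i) else i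

-- smallest positive integer not a part of l (length l + 1 steps suffice)
mex : List ℕ → ℕ
mex l = mexFrom l (suc (length l)) 1

σmex : ℕ → ℕ
σmex m = sum (map mex (partitions m))

-- D₂*(m): pairs (λ₀ , λ₁) where λ₀ are the colour-0 parts and λ₁ the
-- colour-1 parts, |λ₀| + |λ₁| = m, λ₀ = j, j-1, …, 1 for some j,
-- λ₁ has distinct parts, all even.

staircase : ℕ → List ℕ
staircase zero    = []
staircase (suc j) = suc j ∷ staircase j

listEqB : List ℕ → List ℕ → Bool
listEqB []       []       = true
listEqB (x ∷ xs) (y ∷ ys) = (x ≡ᵇ y) ∧ listEqB xs ys
listEqB _        _        = false

isStaircase : List ℕ → Bool
isStaircase l = listEqB l (staircase (length l))

evenB : ℕ → Bool
evenB zero          = true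
evenB (suc zero)    = false
evenB (suc (suc n)) = evenB n

allEven : List ℕ → Bool
allEven []       = true
allEven (x ∷ xs) = evenB x ∧ allEven xs

partitionPairs : ℕ → List (List ℕ × List ℕ)
partitionPairs m =
  concatMap (λ a → cartesianProduct (partitions a) (partitions (m ∸ a))) (upTo (suc m))

isD2 : List ℕ × List ℕ → Bool
isD2 (l0 , l1) = isStaircase l0 ∧ strictDecr l1 ∧ allEven l1

D2* : ℕ → ℕ
D2* m = count isD2 (partitionPairs m)

occ : ℕ → List ℕ → ℕ
occ x l = count (λ y → x ≡ᵇ y) l

-- smallest part of l that is > 2k-1, if any (l weakly decreasing:
-- it is the last such element); returns 0 if none exists
firstBig : ℕ → List ℕ → ℕ
firstBig k []       = 0
firstBig k (x ∷ xs) with firstBig k xs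
... | zero  = if (2 * k ∸ 1) <ᵇ x then x else 0
... | suc y = suc y

isMP : ℕ → List ℕ → Bool
isMP k l =
  let p = firstBig k l in
  (1 ≤ᵇ p) ∧ not (evenB p) ∧ (occ p l ≡ᵇ k)
  ∧ foldr (λ x b → ((x ≡ᵇ p) ∨ evenB x ∨ (occ x l ≤ᵇ 1)) ∧ b) true l

MP : ℕ → ℕ → ℕ
MP k m = count (isMP k) (partitions m)

sgn : ℕ → ℤ
sgn zero    = + 1
sgn (suc e) = - sgn e

tri : ℕ → ℕ
tri j = (j * suc j) / 2

sumℤ : ℕ → (ℕ → ℤ) → ℤ
sumℤ zero    f = f 0
sumℤ (suc n) f = sumℤ n f +ℤ f (suc n)

-- σ mex extended by 0 to negative arguments: σmex(n - t)
σmexSub : ℕ → ℕ → ℤ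
σmexSub n t = if t ≤ᵇ n then + σmex (n ∸ t) else + 0

{-# OPTIONS --safe #-}

-- Work in ℤ[[q]] modulo q^(n+1). Let ψ = Σ_j q^(j(j+1)/2), E = ∏ (1 + q^(2i)), and let
-- A and P be the generating functions of all partitions and of those with distinct odd
-- parts, so that A = E P. Since mex λ counts the j ≥ 0 such that 1, …, j are parts of λ,
-- σmex has generating function ψ A, while D₂* has ψ E. Dividing by ψ E reduces the theorem
-- to θ_k P = 1 + (-1)^(k-1) M_k, where θ_k = Σ_{j<2k} (-q)^(j(j+1)/2) and M_k is the
-- generating function of MP_k.
-- Let M_k(m), P(m) be M_k, P restricted to parts at most 2m. Adjoining the parts 2m+1 and
-- 2m+2 gives linear recurrences in m, from which one gets by induction
--   M_k(m) + M_{k+1}(m) + q^(k(2m+1)) P(k) = q^(k(2k+1)) (1 - q^(2k+1)) P(m)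
-- for m > k, with M_0 = 0. As the third term vanishes for large m unless k = 0, the
-- alternating sum over k telescopes to the reduced identity.
module Submission where

open import Defs
open import Algebra.Bundles using (CommutativeRing)
import Algebra.Properties.CommutativeSemigroup
import Algebra.Solver.Ring
open import Algebra.Solver.Ring.AlmostCommutativeRing using (fromCommutativeRing; _-Raw-AlmostCommutative⟶_)
open import Algebra.Structures using (IsCommutativeRing)
open import Data.Bool using (Bool; true; false; _∧_; _∨_; not; if_then_else_)
open import Data.Bool.Properties using (∧-assoc; ∧-zeroʳ; T-≡; ∨-zeroʳ)
open import Data.Fin as Fin using (Fin)
import Data.Fin.Properties as Fin
open import Data.Integer as ℤ using (ℤ; +_; 0ℤ; 1ℤ)
import Data.Integer.Properties as ℤ
open import Data.List using
  (List; []; _∷_; _++_; map; concatMap; upTo; applyUpTo; length; replicate; foldr; cartesianProduct; lookup)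
open import Data.List.Relation.Unary.All as All using (All; []; _∷_)
import Data.List.Relation.Unary.All.Properties as All
import Data.Maybe as Maybe
open import Data.Nat as ℕ using (ℕ; zero; suc; _≤_; _<_; z≤n; s≤s; _∸_; _≤ᵇ_; _<ᵇ_; _≡ᵇ_)
import Data.Nat.Divisibility as ℕ
import Data.Nat.DivMod as ℕ
open import Data.Nat.ListAction using (sum)
import Data.Nat.Properties as ℕ
open import Data.Nat.Tactic.RingSolver using (solve-∀)
open import Data.Product using (Σ; _×_; _,_; proj₁; proj₂)
open import Data.Sum using (inj₁; inj₂)
open import Function using (_∘_; id; Equivalence)
open import Level using (0ℓ)
open import Relation.Binary.PropositionalEquality as ≡ using (_≡_; _≢_; cong; cong₂)
open import Relation.Nullary using (contradiction)
open import Relation.Nullary.Decidable using (dec⇒maybe)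

-- No infinite series or product occurs. Congruence modulo q^(N+1) makes the coefficient functions a
-- commutative ring, in which bounding the parts by `2B` loses nothing once `N ≤ 2B`. The price is
-- that q is a zero divisor there, so a factor can be cancelled only with an inverse at hand. The
-- factors 1 - q^i get theirs from finite geometric sums, and the division by ψE is never carried
-- out: `assemble` multiplies the reduced identity by ψE instead. The recurrences in m classify
-- partitions by the multiplicity of the largest part allowed. Adjoining an even part is free.
-- Adjoining 2m+1 either leaves the first big part in place, at most one copy being allowed, or
-- creates it, with exactly k copies above parts that are at most 2k-1. The algebra drawn from these
-- recurrences is kept apart from the counting: it is done in any commutative ring with elements
-- `X i` that behave like q^i.

module ℤ+ = Algebra.Properties.CommutativeSemigroup ℤ.+-commutativeSemigroup

-- Formal power series and the Cauchy product

Series : Set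
Series = ℕ → ℤ

infixl 6 _⊕_
infixl 7 _⊛_

0ˢ : Series
0ˢ _ = 0ℤ

const : ℤ → Series
const a zero    = a
const a (suc _) = 0ℤ

-- Opaque, so that the operands of a sum can be inferred from it.
opaque
  _⊕_ : Series → Series → Series
  (f ⊕ g) m = f m ℤ.+ g m

  ⊖_ : Series → Series
  (⊖ f) m = ℤ.- f m

  ⊕-at : ∀ f g m → (f ⊕ g) m ≡ f m ℤ.+ g m
  ⊕-at f g m = ≡.refl

  ⊖-at : ∀ f m → (⊖ f) m ≡ ℤ.- f m
  ⊖-at f m = ≡.refl

-- Splits off the constant term of the left factor, so facts about the left factor are structural
-- inductions; their right-hand versions go through `⊛-comm`.
_⊛_ : Series → Series → Series
(f ⊛ g) zero    = f 0 ℤ.* g 0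
(f ⊛ g) (suc n) = f 0 ℤ.* g (suc n) ℤ.+ (f ∘ suc ⊛ g) n

shift : Series → Series
shift f zero    = 0ℤ
shift f (suc m) = f m

mono : ℕ → Series
mono zero    = const 1ℤ
mono (suc t) = shift (mono t)

⊛-cong-at : ∀ {f f′ g g′} m → (∀ i → i ≤ m → f i ≡ f′ i) → (∀ i → i ≤ m → g i ≡ g′ i) →
            (f ⊛ g) m ≡ (f′ ⊛ g′) m
⊛-cong-at zero    p r = cong₂ ℤ._*_ (p 0 z≤n) (r 0 z≤n)
⊛-cong-at (suc m) p r = cong₂ ℤ._+_ (cong₂ ℤ._*_ (p 0 z≤n) (r (suc m) ℕ.≤-refl))
  (⊛-cong-at m (λ i i≤m → p (suc i) (s≤s i≤m)) (λ i i≤m → r i (ℕ.m≤n⇒m≤1+n i≤m)))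

-- The mirror image of the defining equation, splitting off the constant term of the right factor;
-- commutativity follows from the two together.
⊛-snoc : ∀ f g n → (f ⊛ g) (suc n) ≡ (f ⊛ g ∘ suc) n ℤ.+ f (suc n) ℤ.* g 0
⊛-snoc f g zero    = ≡.refl
⊛-snoc f g (suc n) = ≡.trans (cong (ℤ._+_ (f 0 ℤ.* g (suc (suc n)))) (⊛-snoc (f ∘ suc) g n))
  (≡.sym (ℤ.+-assoc (f 0 ℤ.* g (suc (suc n))) ((f ∘ suc ⊛ g ∘ suc) n) (f (suc (suc n)) ℤ.* g 0)))

⊛-comm : ∀ f g n → (f ⊛ g) n ≡ (g ⊛ f) n
⊛-comm f g zero    = ℤ.*-comm (f 0) (g 0)
⊛-comm f g (suc n) = begin
  f 0 ℤ.* g (suc n) ℤ.+ (f ∘ suc ⊛ g) n ≡⟨ cong₂ ℤ._+_ (ℤ.*-comm (f 0) _) (⊛-comm (f ∘ suc) g n) ⟩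
  g (suc n) ℤ.* f 0 ℤ.+ (g ⊛ f ∘ suc) n ≡⟨ ℤ.+-comm (g (suc n) ℤ.* f 0) _ ⟩
  (g ⊛ f ∘ suc) n ℤ.+ g (suc n) ℤ.* f 0 ≡⟨ ⊛-snoc g f n ⟨
  (g ⊛ f) (suc n)                       ∎
  where open ≡.≡-Reasoning

⊛-zeroˡ : ∀ g n → (0ˢ ⊛ g) n ≡ 0ℤ
⊛-zeroˡ g zero    = ℤ.*-zeroˡ (g 0)
⊛-zeroˡ g (suc n) = cong₂ ℤ._+_ (ℤ.*-zeroˡ (g (suc n))) (⊛-zeroˡ g n)

const-⊛ : ∀ a g n → (const a ⊛ g) n ≡ a ℤ.* g n
const-⊛ a g zero    = ≡.refl
const-⊛ a g (suc n) = ≡.trans (cong (ℤ._+_ (a ℤ.* g (suc n))) (⊛-zeroˡ g n)) (ℤ.+-identityʳ _)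

⊛-scale : ∀ a f g n → ((λ i → a ℤ.* f i) ⊛ g) n ≡ a ℤ.* (f ⊛ g) n
⊛-scale a f g zero    = ℤ.*-assoc a (f 0) (g 0)
⊛-scale a f g (suc n) = ≡.trans
  (cong₂ ℤ._+_ (ℤ.*-assoc a (f 0) (g (suc n))) (⊛-scale a (f ∘ suc) g n))
  (≡.sym (ℤ.*-distribˡ-+ a (f 0 ℤ.* g (suc n)) _))

opaque
  unfolding _⊕_

  ⊛-distribʳ : ∀ f g h n → ((f ⊕ g) ⊛ h) n ≡ (f ⊛ h) n ℤ.+ (g ⊛ h) n
  ⊛-distribʳ f g h zero    = ℤ.*-distribʳ-+ (h 0) (f 0) (g 0)
  ⊛-distribʳ f g h (suc n) = ≡.trans
    (cong₂ ℤ._+_ (ℤ.*-distribʳ-+ (h (suc n)) (f 0) (g 0)) (⊛-distribʳ (f ∘ suc) (g ∘ suc) h n))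
    (ℤ+.interchange (f 0 ℤ.* h (suc n)) (g 0 ℤ.* h (suc n)) _ _)

  ⊛-assoc : ∀ f g h n → ((f ⊛ g) ⊛ h) n ≡ (f ⊛ (g ⊛ h)) n
  ⊛-assoc f g h zero    = ℤ.*-assoc (f 0) (g 0) (h 0)
  ⊛-assoc f g h (suc n) = begin
    f 0 ℤ.* g 0 ℤ.* h (suc n) ℤ.+ ((f ⊛ g) ∘ suc ⊛ h) n
      ≡⟨ cong₂ ℤ._+_ (ℤ.*-assoc (f 0) (g 0) (h (suc n)))
           -- With `⊕` unfolded, `(f ⊛ g) ∘ suc` is by definition the sum of `f 0` times `g ∘ suc`
           -- and `f ∘ suc ⊛ g`.
           (≡.trans (⊛-distribʳ (λ i → f 0 ℤ.* g (suc i)) (f ∘ suc ⊛ g) h n)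
                  (cong₂ ℤ._+_ (⊛-scale (f 0) (g ∘ suc) h n) (⊛-assoc (f ∘ suc) g h n))) ⟩
    f 0 ℤ.* (g 0 ℤ.* h (suc n)) ℤ.+ (f 0 ℤ.* (g ∘ suc ⊛ h) n ℤ.+ (f ∘ suc ⊛ (g ⊛ h)) n)
      ≡⟨ ℤ.+-assoc (f 0 ℤ.* (g 0 ℤ.* h (suc n))) _ _ ⟨
    f 0 ℤ.* (g 0 ℤ.* h (suc n)) ℤ.+ f 0 ℤ.* (g ∘ suc ⊛ h) n ℤ.+ (f ∘ suc ⊛ (g ⊛ h)) n
      ≡⟨ cong (ℤ._+ (f ∘ suc ⊛ (g ⊛ h)) n) (ℤ.*-distribˡ-+ (f 0) (g 0 ℤ.* h (suc n)) _) ⟨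
    (f ⊛ (g ⊛ h)) (suc n) ∎
    where open ≡.≡-Reasoning

-- The conditional on the right is the shape in which shifts occur both in `σmexSub` and in the sums
-- over `gen`.
mono-⊛ : ∀ t f m → (mono t ⊛ f) m ≡ (if t ≤ᵇ m then f (m ∸ t) else 0ℤ)
mono-⊛ zero    f m       = ≡.trans (const-⊛ 1ℤ f m) (ℤ.*-identityˡ (f m))
mono-⊛ (suc t) f zero    = ℤ.*-zeroˡ (f 0)
mono-⊛ (suc t) f (suc m) = ≡.trans (cong (ℤ._+ (mono t ⊛ f) m) (ℤ.*-zeroˡ (f (suc m))))
  (≡.trans (ℤ.+-identityˡ _) (≡.trans (mono-⊛ t f m) (cong (if_then f (m ∸ t) else 0ℤ) (≤ᵇ-suc t m))))
  where
  ≤ᵇ-suc : ∀ t m → (t ≤ᵇ m) ≡ (suc t ≤ᵇ suc m)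
  ≤ᵇ-suc zero    m = ≡.refl
  ≤ᵇ-suc (suc t) m = ≡.refl

mono-+ : ∀ i j m → mono (i ℕ.+ j) m ≡ (mono i ⊛ mono j) m
mono-+ zero    j m       = ≡.sym (≡.trans (const-⊛ 1ℤ (mono j) m) (ℤ.*-identityˡ _))
mono-+ (suc i) j zero    = ≡.sym (ℤ.*-zeroˡ (mono j 0))
mono-+ (suc i) j (suc m) = ≡.trans (mono-+ i j m)
  (≡.sym (≡.trans (cong (ℤ._+ (mono i ⊛ mono j) m) (ℤ.*-zeroˡ (mono j (suc m)))) (ℤ.+-identityˡ _)))

mono-vanish : ∀ t m → m ℕ.< t → mono t m ≡ 0ℤ
mono-vanish (suc t) zero    _         = ≡.refl
mono-vanish (suc t) (suc m) (s≤s m<t) = mono-vanish t m m<t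

-- The ring of series modulo q^(N+1)

module Truncated (N : ℕ) where

  infix 4 _≈_
  record _≈_ (f g : Series) : Set where
    constructor agree
    field at : ∀ m → m ≤ N → f m ≡ g m
  open _≈_ public

  pointwise : ∀ {f g} → (∀ m → f m ≡ g m) → f ≈ g
  pointwise p = agree (λ m _ → p m)

  ⊛-cong : ∀ {f f′ g g′} → f ≈ f′ → g ≈ g′ → f ⊛ g ≈ f′ ⊛ g′
  ⊛-cong p r = agree λ m m≤N → ⊛-cong-at m
    (λ i i≤m → at p i (ℕ.≤-trans i≤m m≤N)) (λ i i≤m → at r i (ℕ.≤-trans i≤m m≤N))

  opaque
    unfolding _⊕_ ⊖_

    isCommutativeRing : IsCommutativeRing _≈_ _⊕_ _⊛_ ⊖_ 0ˢ (const 1ℤ)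
    isCommutativeRing = record
      { isRing = record
        { +-isAbelianGroup = record
          { isGroup = record
            { isMonoid = record
              { isSemigroup = record
                { isMagma = record
                  { isEquivalence = record
                    { refl = pointwise λ _ → ≡.refl
                    ; sym = λ p → agree λ m m≤N → ≡.sym (at p m m≤N)
                    ; trans = λ p r → agree λ m m≤N → ≡.trans (at p m m≤N) (at r m m≤N)
                    }
                  ; ∙-cong = λ p r → agree λ m m≤N → cong₂ ℤ._+_ (at p m m≤N) (at r m m≤N)
                  }
                ; assoc = λ f g h → pointwise λ m → ℤ.+-assoc (f m) (g m) (h m)
                }
              ; identity = (λ f → pointwise λ m → ℤ.+-identityˡ (f m))
                         , (λ f → pointwise λ m → ℤ.+-identityʳ (f m))
              }
            ; inverse = (λ f → pointwise λ m → ℤ.+-inverseˡ (f m))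
                      , (λ f → pointwise λ m → ℤ.+-inverseʳ (f m))
            ; ⁻¹-cong = λ p → agree λ m m≤N → cong ℤ.-_ (at p m m≤N)
            }
          ; comm = λ f g → pointwise λ m → ℤ.+-comm (f m) (g m)
          }
        ; *-cong = ⊛-cong
        ; *-assoc = λ f g h → pointwise (⊛-assoc f g h)
        ; *-identity = (λ f → pointwise (one-⊛ f))
                     , (λ f → pointwise λ m → ≡.trans (⊛-comm f _ m) (one-⊛ f m))
        ; distrib = (λ f g h → pointwise λ m → ≡.trans (⊛-comm f (g ⊕ h) m)
                      (≡.trans (⊛-distribʳ g h f m) (cong₂ ℤ._+_ (⊛-comm g f m) (⊛-comm h f m))))
                  , (λ f g h → pointwise (⊛-distribʳ g h f))
        }
      ; *-comm = λ f g → pointwise (⊛-comm f g)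
      }
      where
      one-⊛ : ∀ f m → (const 1ℤ ⊛ f) m ≡ f m
      one-⊛ f m = ≡.trans (const-⊛ 1ℤ f m) (ℤ.*-identityˡ (f m))

  ring : CommutativeRing 0ℓ 0ℓ
  ring = record { isCommutativeRing = isCommutativeRing }

  pointwise-⊕ : ∀ {f g h} → (∀ m → h m ≡ f m ℤ.+ g m) → h ≈ f ⊕ g
  pointwise-⊕ {f} {g} p = pointwise λ m → ≡.trans (p m) (≡.sym (⊕-at f g m))

  pointwise-⊖ : ∀ {f h} → (∀ m → h m ≡ ℤ.- f m) → h ≈ ⊖ f
  pointwise-⊖ {f} p = pointwise λ m → ≡.trans (p m) (≡.sym (⊖-at f m))

-- Defined by recursion so that `double (suc m)` reduces to two successors and each of the parts
-- 2m+1 and 2m+2 can be adjoined by one `suc`.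
double : ℕ → ℕ
double zero    = zero
double (suc m) = suc (suc (double m))

double≡+ : ∀ m → double m ≡ m ℕ.+ m
double≡+ zero    = ≡.refl
double≡+ (suc m) = cong suc (≡.trans (cong suc (double≡+ m)) (≡.sym (ℕ.+-suc m m)))

-- The q-series identities in an abstract commutative ring

module QSeries
  (R : CommutativeRing 0ℓ 0ℓ)
  (ι : ℤ.+-*-rawRing -Raw-AlmostCommutative⟶ fromCommutativeRing R)
  (X : ℕ → CommutativeRing.Carrier R)
  (X-zero : CommutativeRing._≈_ R (X 0) (_-Raw-AlmostCommutative⟶_.⟦_⟧ ι ℤ.1ℤ))
  (X-+ : ∀ i j → CommutativeRing._≈_ R (X (i ℕ.+ j)) (CommutativeRing._*_ R (X i) (X j)))
  where

  open CommutativeRing R hiding (1#)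
  open import Relation.Binary.Reasoning.Setoid setoid
  open _-Raw-AlmostCommutative⟶_ ι using (⟦_⟧; 0-homo)
  open Algebra.Solver.Ring ℤ.+-*-rawRing (fromCommutativeRing R) ι
    (λ i j → Maybe.map (λ p → reflexive (cong ⟦_⟧ p)) (dec⇒maybe (i ℤ.≟ j)))
    using (Polynomial; solve; con; _:=_; _:+_; _:*_; _:-_; :-_) public

  -- The solver reifies its coefficient 1 as ⟦ 1ℤ ⟧ rather than 1#.
  1# : Carrier
  1# = ⟦ ℤ.1ℤ ⟧

  :1 : ∀ {n} → Polynomial n
  :1 = con ℤ.1ℤ

  infix 4 _invertibleBy_
  _invertibleBy_ : Carrier → Carrier → Set
  d invertibleBy g = d * g ≈ 1#

  cancel : ∀ {d g a b} → d invertibleBy g → d * a ≈ d * b → a ≈ b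
  cancel {d} {g} {a} {b} dg≈1 da≈db = begin
    a           ≈⟨ unit a ⟨
    1# * a      ≈⟨ *-congʳ dg≈1 ⟨
    d * g * a   ≈⟨ swap d g a ⟩
    g * (d * a) ≈⟨ *-congˡ da≈db ⟩
    g * (d * b) ≈⟨ swap d g b ⟨
    d * g * b   ≈⟨ *-congʳ dg≈1 ⟩
    1# * b      ≈⟨ unit b ⟩
    b           ∎
    where
    unit : ∀ a → 1# * a ≈ a
    unit = solve 1 (λ a → :1 :* a := a) refl
    swap : ∀ d g a → d * g * a ≈ g * (d * a)
    swap = solve 3 (λ d g a → d :* g :* a := g :* (d :* a)) refl

  X-≡ : ∀ {i} j l → i ≡ j ℕ.+ l → X i ≈ X j * X l
  X-≡ j l ≡.refl = X-+ j l

  -- P m, U m and V m are the generating functions, with parts at most 2m, of the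
  -- partitions with distinct odd parts and of those counted by MP_k and MP_{k+1}.
  module Telescope
    (g : ℕ → Carrier) (inverse : ∀ i → (1# - X (suc i)) invertibleBy g (suc i))
    (P U V : ℕ → Carrier) (k : ℕ)
    (P-step : ∀ m → (1# - X (double (suc m))) * P (suc m) ≈ (1# + X (suc (double m))) * P m)
    -- The last term counts the partitions where 2m+1 becomes the first big part: `k` copies of it
    -- above a partition with distinct odd parts and all parts at most 2k-1, whose generating
    -- function is `(1# - X (double k)) * P k`.
    (U-step : ∀ m → k ≤ m → (1# - X (double (suc m))) * U (suc m) ≈
                (1# + X (suc (double m))) * U m
                + X (k ℕ.* suc (double m)) * ((1# - X (double k)) * P k))
    (V-step : ∀ m → suc k ≤ m → (1# - X (double (suc m))) * V (suc m) ≈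
                (1# + X (suc (double m))) * V m
                + X (suc k ℕ.* suc (double m)) * ((1# - X (double (suc k))) * P (suc k)))
    (U-init : U k ≈ 0#) (V-init : V (suc k) ≈ 0#)
    where

    X-next : ∀ m → X (k ℕ.* suc (double (suc m))) ≈ X (k ℕ.* suc (double m)) * (X k * X k)
    X-next m = trans (X-≡ (k ℕ.* suc (double m)) (k ℕ.+ k) (arith k (double m)))
                     (*-congˡ (X-+ k k))
      where
      arith : ∀ k e → k ℕ.* suc (suc (suc e)) ≡ k ℕ.* suc e ℕ.+ (k ℕ.+ k)
      arith = solve-∀

    X-double : X (double k) ≈ X k * X k
    X-double = X-≡ k k (double≡+ k)

    X-suc : ∀ i → X (suc i) ≈ X 1 * X i
    X-suc i = X-+ 1 i

    -- Turns the source term of `V` into a multiple of `P k`, so that it can be combined with that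
    -- of `U`.
    P-suc-k : (1# - X (double (suc k))) * P (suc k) ≈ (1# + X 1 * (X k * X k)) * P k
    P-suc-k = trans (P-step k) (*-congʳ (+-congˡ (trans (X-suc (double k)) (*-congˡ X-double))))

    -- The term `X (k ℕ.* suc (double m)) * P k` is minus a particular solution of the recurrence
    -- for `U + V`. The left side therefore obeys the homogeneous recurrence, which is that of `P`,
    -- and must be a fixed multiple of `P m`; its value at `m = suc k` gives the factor.
    Claim : ℕ → Set
    Claim m = U m + V m + X (k ℕ.* suc (double m)) * P k
              ≈ X (k ℕ.* suc (double k)) * ((1# - X (suc (double k))) * P m)

    -- Induction starts at `suc k`, where `V` vanishes and `U` consists of its source term alone.
    -- The coefficients add up to 1 - q²w⁴ = (1 - qw²)(1 + qw²): the first factor is the constant in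
    -- `Claim`, the second takes `P k` to `d * P (suc k)`.
    base : Claim (suc k)
    base = cancel (inverse (suc (double k))) (begin
      d * (U (suc k) + V (suc k) + X (k ℕ.* suc (double (suc k))) * P k)
        ≈⟨ *-congˡ (+-cong (trans (+-congˡ V-init) (+-identityʳ _)) (*-congʳ (X-next k))) ⟩
      d * (U (suc k) + y * (w * w) * P k)
        ≈⟨ distribˡ d _ _ ⟩
      d * U (suc k) + d * (y * (w * w) * P k)
        ≈⟨ +-cong U-suc (*-congʳ d≈) ⟩
      y * ((1# - w * w) * P k) + (1# - q * (q * (w * w))) * (y * (w * w) * P k)
        ≈⟨ solve 4 (λ y w q p → y :* ((:1 :- w :* w) :* p)
                     :+ (:1 :- q :* (q :* (w :* w))) :* (y :* (w :* w) :* p)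
                   := y :* ((:1 :- q :* (w :* w)) :* ((:1 :+ q :* (w :* w)) :* p)))
             refl y w q (P k) ⟩
      y * ((1# - q * (w * w)) * ((1# + q * (w * w)) * P k))
        ≈⟨ *-congˡ (*-cong (+-congˡ (-‿cong (trans (X-suc (double k)) (*-congˡ X-double)))) P-suc-k) ⟨
      y * ((1# - X (suc (double k))) * (d * P (suc k)))
        ≈⟨ solve 4 (λ y e d p → y :* (e :* (d :* p)) := d :* (y :* (e :* p)))
             refl y (1# - X (suc (double k))) d (P (suc k)) ⟩
      d * (y * ((1# - X (suc (double k))) * P (suc k))) ∎)
      where
      q = X 1
      w = X k
      y = X (k ℕ.* suc (double k))
      d = 1# - X (double (suc k))
      d≈ : d ≈ 1# - q * (q * (w * w))
      d≈ = +-congˡ (-‿cong (trans (X-suc (suc (double k)))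
             (*-congˡ (trans (X-suc (double k)) (*-congˡ X-double)))))
      U-suc : d * U (suc k) ≈ y * ((1# - w * w) * P k)
      U-suc = begin
        d * U (suc k)
          ≈⟨ U-step k ℕ.≤-refl ⟩
        (1# + X (suc (double k))) * U k + y * ((1# - X (double k)) * P k)
          ≈⟨ +-cong (trans (*-congˡ U-init) (zeroʳ _)) (*-congˡ (*-congʳ (+-congˡ (-‿cong X-double)))) ⟩
        0# + y * ((1# - w * w) * P k)
          ≈⟨ +-identityˡ _ ⟩
        y * ((1# - w * w) * P k) ∎

    step : ∀ m → suc k ≤ m → Claim m → Claim (suc m)
    step m k<m ih = cancel (inverse (suc (double m))) (begin
      d * (U (suc m) + V (suc m) + X (k ℕ.* suc (double (suc m))) * P k)
        ≈⟨ *-congˡ (+-congˡ (*-congʳ (X-next m))) ⟩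
      d * (U (suc m) + V (suc m) + y * (w * w) * P k)
        ≈⟨ solve 4 (λ d u v t → d :* (u :+ v :+ t) := d :* u :+ d :* v :+ d :* t)
             refl d (U (suc m)) (V (suc m)) (y * (w * w) * P k) ⟩
      d * U (suc m) + d * V (suc m) + d * (y * (w * w) * P k)
        ≈⟨ +-cong (+-cong U-suc V-suc) (*-congʳ (+-congˡ (-‿cong (X-suc (suc (double m)))))) ⟩
      (1# + z) * U m + y * ((1# - w * w) * P k) + ((1# + z) * V m + z * y * ((1# + q * (w * w)) * P k))
        + (1# - q * z) * (y * (w * w) * P k)
        -- The coefficient of `y * P k` is (1 - w²) + z(1 + qw²) + (1 - qz)w² = 1 + z.
        ≈⟨ solve 7 (λ q w y z u v p → (:1 :+ z) :* u :+ y :* ((:1 :- w :* w) :* p)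
                     :+ ((:1 :+ z) :* v :+ z :* y :* ((:1 :+ q :* (w :* w)) :* p))
                     :+ (:1 :- q :* z) :* (y :* (w :* w) :* p)
                   := (:1 :+ z) :* (u :+ v :+ y :* p))
             refl q w y z (U m) (V m) (P k) ⟩
      (1# + z) * (U m + V m + y * P k)
        ≈⟨ *-congˡ ih ⟩
      (1# + z) * (c * (e * P m))
        ≈⟨ solve 4 (λ z c e p → z :* (c :* (e :* p)) := c :* (e :* (z :* p))) refl (1# + z) c e (P m) ⟩
      c * (e * ((1# + z) * P m))
        ≈⟨ *-congˡ (*-congˡ (P-step m)) ⟨
      c * (e * (d * P (suc m)))
        ≈⟨ solve 4 (λ d c e p → c :* (e :* (d :* p)) := d :* (c :* (e :* p))) refl d c e (P (suc m)) ⟩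
      d * (c * (e * P (suc m))) ∎)
      where
      q = X 1
      w = X k
      y = X (k ℕ.* suc (double m))
      z = X (suc (double m))
      c = X (k ℕ.* suc (double k))
      e = 1# - X (suc (double k))
      d = 1# - X (double (suc m))
      U-suc : d * U (suc m) ≈ (1# + z) * U m + y * ((1# - w * w) * P k)
      U-suc = trans (U-step m (ℕ.<⇒≤ k<m)) (+-congˡ (*-congˡ (*-congʳ (+-congˡ (-‿cong X-double)))))
      V-suc : d * V (suc m) ≈ (1# + z) * V m + z * y * ((1# + q * (w * w)) * P k)
      V-suc = trans (V-step m k<m) (+-congˡ (*-cong (X-+ (suc (double m)) (k ℕ.* suc (double m))) P-suc-k))

    telescope : ∀ m → suc k ≤ m → Claim m
    telescope m k<m = ≡.subst Claim (ℕ.m∸n+n≡m k<m) (go (m ℕ.∸ suc k))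
      where
      go : ∀ t → Claim (t ℕ.+ suc k)
      go zero    = base
      go (suc t) = step (t ℕ.+ suc k) (ℕ.m≤n+m (suc k) t) (go t)

  module Truncation
    (N B : ℕ) (N≤2B : N ≤ double B) (X-vanish : ∀ i → N ℕ.< i → X i ≈ 0#)
    (g : ℕ → Carrier) (inverse : ∀ i → (1# - X (suc i)) invertibleBy g (suc i))
    (P : ℕ → Carrier) (P-zero : P 0 ≈ 1#)
    (P-step : ∀ m → (1# - X (double (suc m))) * P (suc m) ≈ (1# + X (suc (double m))) * P m)
    where

    s : ℕ → Carrier
    s zero    = 1#
    s (suc k) = - s k

    -- Adds the terms j = 2k and j = 2k + 1 of Σ_j (-q)^(j(j+1)/2) at once.
    θ : ℕ → Carrier
    θ zero    = 0#
    θ (suc k) = θ k + s k * (X (k ℕ.* suc (double k)) - X (suc k ℕ.* suc (double k)))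

    module _
      (M : ℕ → ℕ → Carrier)
      (M-step : ∀ k m → suc k ≤ m → (1# - X (double (suc m))) * M (suc k) (suc m) ≈
                  (1# + X (suc (double m))) * M (suc k) m
                  + X (suc k ℕ.* suc (double m)) * ((1# - X (double (suc k))) * P (suc k)))
      (M-init : ∀ k → M (suc k) (suc k) ≈ 0#)
      where

      -- Each new pair of terms of `θ` is the right side of one instance of `Claim`, and replaces
      -- `M (suc k)` by `M (suc (suc k))` with the opposite sign.
      θ-truncated : ∀ k → suc k ≤ B → θ (suc k) * P B + s (suc k) * M (suc k) B ≈ 1#
      θ-truncated zero 1≤B = begin
        (0# + 1# * (X 0 - X 1)) * P B + - 1# * M 1 B
          ≈⟨ +-congʳ (*-congʳ (trans (+-identityˡ _) (*-congˡ (+-congʳ X-zero)))) ⟩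
        1# * (1# - X 1) * P B + - 1# * M 1 B
          ≈⟨ solve 3 (λ x p m → :1 :* (:1 :- x) :* p :+ (:- :1) :* m := :1 :* ((:1 :- x) :* p) :- m)
               refl (X 1) (P B) (M 1 B) ⟩
        1# * ((1# - X 1) * P B) - M 1 B
          ≈⟨ +-congʳ (*-congʳ X-zero) ⟨
        X 0 * ((1# - X 1) * P B) - M 1 B
          -- For `k = 0` the zero sequence can serve as `U`, since its source term has the factor
          -- `1# - X 0`. The remainder `X 0 * P 0` supplies the 1 on the right.
          ≈⟨ +-congʳ (Telescope.telescope g inverse P (λ _ → 0#) (M 1) 0 P-step
               (λ m _ → degenerate (1# - X (double (suc m))) (1# + X (suc (double m))))
               (M-step 0) refl (M-init 0) B 1≤B) ⟨
        0# + M 1 B + X 0 * P 0 - M 1 B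
          ≈⟨ +-congʳ (+-cong (+-identityˡ _) (*-cong X-zero P-zero)) ⟩
        M 1 B + 1# * 1# - M 1 B
          ≈⟨ solve 1 (λ m → m :+ :1 :* :1 :- m := :1) refl (M 1 B) ⟩
        1# ∎
        where
        degenerate : ∀ d f → d * 0# ≈ f * 0# + X 0 * ((1# - X 0) * P 0)
        degenerate d f = begin
          d * 0#                                ≈⟨ zeroʳ d ⟩
          0#                                    ≈⟨ +-identityˡ 0# ⟨
          0# + 0#                               ≈⟨ +-cong (zeroʳ f) (trans (*-congˡ (zeroˡ (P 0))) (zeroʳ (X 0))) ⟨
          f * 0# + X 0 * (0# * P 0)             ≈⟨ +-congˡ (*-congˡ (*-congʳ (-‿inverseʳ (X 0)))) ⟨
          f * 0# + X 0 * ((X 0 - X 0) * P 0)    ≈⟨ +-congˡ (*-congˡ (*-congʳ (+-congʳ X-zero))) ⟩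
          f * 0# + X 0 * ((1# - X 0) * P 0)     ∎
      θ-truncated (suc k) k<B = begin
        (θ κ + s κ * (c - X (suc κ ℕ.* suc (double κ)))) * P B + - s κ * M (suc κ) B
          ≈⟨ +-congʳ (*-congʳ (+-congˡ (*-congˡ (+-congˡ (-‿cong (X-+ (suc (double κ)) _)))))) ⟩
        (θ κ + s κ * (c - x * c)) * P B + - s κ * M (suc κ) B
          ≈⟨ solve 6 (λ t σ c x p v → (t :+ σ :* (c :- x :* c)) :* p :+ (:- σ) :* v
                                    := t :* p :+ σ :* (c :* ((:1 :- x) :* p) :- v))
               refl (θ κ) (s κ) c x (P B) (M (suc κ) B) ⟩
        θ κ * P B + s κ * (c * ((1# - x) * P B) - M (suc κ) B)
          ≈⟨ +-congˡ (*-congˡ (+-congʳ (Telescope.telescope g inverse P (M κ) (M (suc κ)) κ P-step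
               (M-step k) (M-step κ) (M-init k) (M-init κ) B k<B))) ⟨
        θ κ * P B + s κ * (M κ B + M (suc κ) B + X (κ ℕ.* suc (double B)) * P κ - M (suc κ) B)
          ≈⟨ +-congˡ (*-congˡ (+-congʳ (trans (+-congˡ (trans (*-congʳ (X-vanish _ large)) (zeroˡ _)))
                                              (+-identityʳ _)))) ⟩
        θ κ * P B + s κ * (M κ B + M (suc κ) B - M (suc κ) B)
          ≈⟨ solve 4 (λ t σ u v → t :+ σ :* (u :+ v :- v) := t :+ σ :* u)
               refl (θ κ * P B) (s κ) (M κ B) (M (suc κ) B) ⟩
        θ κ * P B + s κ * M κ B
          ≈⟨ θ-truncated k (ℕ.<⇒≤ k<B) ⟩
        1# ∎
        where
        κ = suc k
        c = X (κ ℕ.* suc (double κ))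
        x = X (suc (double κ))
        -- Here `κ` is positive, so the exponent is at least 2B+1.
        large : N ℕ.< κ ℕ.* suc (double B)
        large = ℕ.≤-trans (s≤s N≤2B) (ℕ.m≤m+n (suc (double B)) _)

    module _
      (E A : ℕ → Carrier)
      (E-zero : E 0 ≈ 1#) (E-step : ∀ m → E (suc m) ≈ (1# + X (double (suc m))) * E m)
      (A-zero : A 0 ≈ 1#) (A-step : ∀ b → (1# - X (suc b)) * A (suc b) ≈ A b)
      where

      private
        -- Finite products: `Q b` is ∏ (1 - q^(2i)) and `F b` is ∏ (1 + q^i) over 1 ≤ i ≤ b. They
        -- clear the denominators of E P and of A.
        Q Q⁻¹ F : ℕ → Carrier
        Q zero    = 1#
        Q (suc b) = (1# - X (double (suc b))) * Q b
        Q⁻¹ zero    = 1#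
        Q⁻¹ (suc b) = g (double (suc b)) * Q⁻¹ b
        F zero    = 1#
        F (suc b) = (1# + X (suc b)) * F b

        Q-invertible : ∀ b → Q b invertibleBy Q⁻¹ b
        Q-invertible zero    = solve 0 (:1 :* :1 := :1) refl
        Q-invertible (suc b) = begin
          d * Q b * (g (double (suc b)) * Q⁻¹ b)
            ≈⟨ solve 4 (λ d q g h → d :* q :* (g :* h) := d :* g :* (q :* h)) refl d (Q b) _ (Q⁻¹ b) ⟩
          d * g (double (suc b)) * (Q b * Q⁻¹ b)
            ≈⟨ *-cong (inverse (suc (double b))) (Q-invertible b) ⟩
          1# * 1#
            ≈⟨ solve 0 (:1 :* :1 := :1) refl ⟩
          1# ∎
          where d = 1# - X (double (suc b))

        -- `E` contributes the factors 1 + q^i with i even, the numerator of `P` those with i odd.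
        Q*EP≈F : ∀ m → Q m * (E m * P m) ≈ F (double m)
        Q*EP≈F zero    = trans (*-congˡ (*-cong E-zero P-zero)) (solve 0 (:1 :* (:1 :* :1) := :1) refl)
        Q*EP≈F (suc m) = begin
          d * Q m * (E (suc m) * P (suc m))
            ≈⟨ *-congˡ (*-congʳ (E-step m)) ⟩
          d * Q m * (e * E m * P (suc m))
            ≈⟨ solve 5 (λ d q e f p → d :* q :* (e :* f :* p) := e :* (q :* (f :* (d :* p))))
                 refl d (Q m) e (E m) (P (suc m)) ⟩
          e * (Q m * (E m * (d * P (suc m))))
            ≈⟨ *-congˡ (*-congˡ (*-congˡ (P-step m))) ⟩
          e * (Q m * (E m * (o * P m)))
            ≈⟨ solve 5 (λ e q f o p → e :* (q :* (f :* (o :* p))) := e :* (o :* (q :* (f :* p))))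
                 refl e (Q m) (E m) o (P m) ⟩
          e * (o * (Q m * (E m * P m)))
            ≈⟨ *-congˡ (*-congˡ (Q*EP≈F m)) ⟩
          e * (o * F (double m)) ∎
          where
          d = 1# - X (double (suc m))
          e = 1# + X (double (suc m))
          o = 1# + X (suc (double m))

        -- Factor by factor, 1 + x = (1 - x²) / (1 - x).
        F≈Q*A : ∀ b → F b ≈ Q b * A b
        F≈Q*A zero    = trans (solve 0 (:1 := :1 :* :1) refl) (*-congˡ (sym A-zero))
        F≈Q*A (suc b) = begin
          (1# + x) * F b
            ≈⟨ *-congˡ (F≈Q*A b) ⟩
          (1# + x) * (Q b * A b)
            ≈⟨ *-congˡ (*-congˡ (A-step b)) ⟨
          (1# + x) * (Q b * ((1# - x) * A (suc b)))
            ≈⟨ solve 3 (λ x q a → (:1 :+ x) :* (q :* ((:1 :- x) :* a)) := (:1 :- x :* x) :* q :* a)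
                 refl x (Q b) (A (suc b)) ⟩
          (1# - x * x) * Q b * A (suc b)
            ≈⟨ *-congʳ (*-congʳ (+-congˡ (-‿cong (X-≡ (suc b) (suc b) (double≡+ (suc b)))))) ⟨
          Q (suc b) * A (suc b) ∎
          where x = X (suc b)

        -- Reconciles the denominators: E P has `Q B`, whereas `A (double B)` has `Q (double B)`.
        -- The extra factors are 1 modulo q^(N+1).
        Q-stable : ∀ t → Q (t ℕ.+ B) ≈ Q B
        Q-stable zero    = refl
        Q-stable (suc t) = begin
          (1# - X (double (suc t ℕ.+ B))) * Q (t ℕ.+ B)
            ≈⟨ *-cong (+-congˡ (-‿cong (trans (X-vanish _ large) (sym 0-homo)))) (Q-stable t) ⟩
          (1# - ⟦ ℤ.0ℤ ⟧) * Q B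
            ≈⟨ solve 1 (λ q → (:1 :- con ℤ.0ℤ) :* q := q) refl (Q B) ⟩
          Q B ∎
          where
          double-mono : ∀ t → double B ≤ double (t ℕ.+ B)
          double-mono zero    = ℕ.≤-refl
          double-mono (suc t) = ℕ.m≤n⇒m≤1+n (ℕ.m≤n⇒m≤1+n (double-mono t))
          large : N ℕ.< double (suc t ℕ.+ B)
          large = s≤s (ℕ.≤-trans N≤2B (ℕ.m≤n⇒m≤1+n (double-mono t)))

      E*P≈A : E B * P B ≈ A (double B)
      E*P≈A = cancel (Q-invertible B) (begin
        Q B * (E B * P B)           ≈⟨ Q*EP≈F B ⟩
        F (double B)                ≈⟨ F≈Q*A (double B) ⟩
        Q (double B) * A (double B) ≈⟨ *-congʳ (≡.subst (λ b → Q b ≈ Q B) (≡.sym (double≡+ B)) (Q-stable B)) ⟩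
        Q B * A (double B)          ∎)

    s-square : ∀ k → s k * s k ≈ 1#
    s-square zero    = solve 0 (:1 :* :1 := :1) refl
    s-square (suc k) = trans (solve 1 (λ x → (:- x) :* (:- x) := x :* x) refl (s k)) (s-square k)

    assemble : ∀ {σ D ψ a e} m k → θ (suc k) * P B + s (suc k) * m ≈ 1# → e * P B ≈ a →
               σ ≈ ψ * a → D ≈ ψ * e → s k * (θ (suc k) * σ - D) ≈ m * D
    assemble {σ} {D} {ψ} {a} {e} m k trunc ep σ≈ D≈ = begin
      s k * (t * σ - D)
        ≈⟨ *-congˡ (+-cong (*-congˡ (trans σ≈ (*-congˡ (sym ep)))) (-‿cong D≈)) ⟩
      s k * (t * (ψ * (e * P B)) - ψ * e)
        -- Adding and subtracting `(s k * s k) * (m * (ψ * e))` makes the truncated identity minus 1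
        -- a factor of the first summand.
        ≈⟨ solve 6 (λ s t ψ e p m → s :* (t :* (ψ :* (e :* p)) :- ψ :* e)
                    := s :* (ψ :* e) :* ((t :* p :+ (:- s) :* m) :- :1) :+ (s :* s) :* (m :* (ψ :* e)))
             refl (s k) t ψ e (P B) m ⟩
      s k * (ψ * e) * ((t * P B + - s k * m) - 1#) + (s k * s k) * (m * (ψ * e))
        ≈⟨ +-cong (*-congˡ (trans (+-congʳ trunc) (-‿inverseʳ 1#))) (*-congʳ (s-square k)) ⟩
      s k * (ψ * e) * 0# + 1# * (m * (ψ * e))
        ≈⟨ trans (+-congʳ (zeroʳ _)) (+-identityˡ _) ⟩
      1# * (m * (ψ * e))
        ≈⟨ solve 1 (λ x → :1 :* x := x) refl (m * (ψ * e)) ⟩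
      m * (ψ * e)
        ≈⟨ *-congˡ D≈ ⟨
      m * D ∎
      where t = θ (suc k)

-- Sums over lists

sumOver : {A : Set} → (A → ℤ) → List A → ℤ
sumOver f []       = 0ℤ
sumOver f (x ∷ xs) = f x ℤ.+ sumOver f xs

⟦_⟧ : Bool → ℤ
⟦ true ⟧  = 1ℤ
⟦ false ⟧ = 0ℤ

⟦∧⟧ : ∀ p q → ⟦ p ∧ q ⟧ ≡ ⟦ p ⟧ ℤ.* ⟦ q ⟧
⟦∧⟧ true  q = ≡.sym (ℤ.*-identityˡ ⟦ q ⟧)
⟦∧⟧ false q = ≡.sym (ℤ.*-zeroˡ ⟦ q ⟧)

module _ {A : Set} where

  sumOver-cong : ∀ {f g : A → ℤ} {xs} → All (λ x → f x ≡ g x) xs → sumOver f xs ≡ sumOver g xs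
  sumOver-cong []       = ≡.refl
  sumOver-cong (p ∷ ps) = cong₂ ℤ._+_ p (sumOver-cong ps)

  sumOver-++ : ∀ (f : A → ℤ) xs ys → sumOver f (xs ++ ys) ≡ sumOver f xs ℤ.+ sumOver f ys
  sumOver-++ f []       ys = ≡.sym (ℤ.+-identityˡ _)
  sumOver-++ f (x ∷ xs) ys = ≡.trans (cong (ℤ._+_ (f x)) (sumOver-++ f xs ys)) (≡.sym (ℤ.+-assoc (f x) _ _))

  sumOver-+ : ∀ (f g : A → ℤ) xs → sumOver (λ x → f x ℤ.+ g x) xs ≡ sumOver f xs ℤ.+ sumOver g xs
  sumOver-+ f g []       = ≡.refl
  sumOver-+ f g (x ∷ xs) = ≡.trans (cong (ℤ._+_ (f x ℤ.+ g x)) (sumOver-+ f g xs))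
    (ℤ+.interchange (f x) (g x) (sumOver f xs) (sumOver g xs))

  sumOver-* : ∀ a (f : A → ℤ) xs → sumOver (λ x → a ℤ.* f x) xs ≡ a ℤ.* sumOver f xs
  sumOver-* a f []       = ≡.sym (ℤ.*-zeroʳ a)
  sumOver-* a f (x ∷ xs) = ≡.trans (cong (ℤ._+_ (a ℤ.* f x)) (sumOver-* a f xs))
    (≡.sym (ℤ.*-distribˡ-+ a (f x) (sumOver f xs)))

  sumOver-map : ∀ {B : Set} (f : A → ℤ) (h : B → A) xs → sumOver f (map h xs) ≡ sumOver (f ∘ h) xs
  sumOver-map f h []       = ≡.refl
  sumOver-map f h (x ∷ xs) = cong (ℤ._+_ (f (h x))) (sumOver-map f h xs)

  sumOver-concatMap : ∀ {B : Set} (f : A → ℤ) (h : B → List A) xs →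
                      sumOver f (concatMap h xs) ≡ sumOver (λ x → sumOver f (h x)) xs
  sumOver-concatMap f h []       = ≡.refl
  sumOver-concatMap f h (x ∷ xs) = ≡.trans (sumOver-++ f (h x) (concatMap h xs))
    (cong (ℤ._+_ (sumOver f (h x))) (sumOver-concatMap f h xs))

  count-sumOver : ∀ (p : A → Bool) xs → + count p xs ≡ sumOver (⟦_⟧ ∘ p) xs
  count-sumOver p []       = ≡.refl
  count-sumOver p (x ∷ xs) with p x
  ... | true  = ≡.trans (ℤ.pos-+ 1 (count p xs)) (cong (ℤ._+_ 1ℤ) (count-sumOver p xs))
  ... | false = ≡.trans (count-sumOver p xs) (≡.sym (ℤ.+-identityˡ _))

  sum-sumOver : ∀ (h : A → ℕ) xs → + sum (map h xs) ≡ sumOver (+_ ∘ h) xs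
  sum-sumOver h []       = ≡.refl
  sum-sumOver h (x ∷ xs) = ≡.trans (ℤ.pos-+ (h x) _) (cong (ℤ._+_ (+ h x)) (sum-sumOver h xs))

  filterB-all : ∀ {p : A → Bool} {xs} → All (λ x → p x ≡ true) xs → filterB p xs ≡ xs
  filterB-all []                = ≡.refl
  filterB-all {p} {x ∷ xs} (e ∷ es) rewrite e = cong (x ∷_) (filterB-all es)

Σ< : ℕ → (ℕ → ℤ) → ℤ
Σ< zero    c = 0ℤ
Σ< (suc M) c = c 0 ℤ.+ Σ< M (c ∘ suc)

sumOver-applyUpTo : ∀ (c : ℕ → ℤ) h M → sumOver c (applyUpTo h M) ≡ Σ< M (c ∘ h)
sumOver-applyUpTo c h zero    = ≡.refl
sumOver-applyUpTo c h (suc M) = cong (ℤ._+_ (c (h 0))) (sumOver-applyUpTo c (h ∘ suc) M)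

Σ<-cong : ∀ M {c d} → (∀ t → c t ≡ d t) → Σ< M c ≡ Σ< M d
Σ<-cong zero    p = ≡.refl
Σ<-cong (suc M) p = cong₂ ℤ._+_ (p 0) (Σ<-cong M (p ∘ suc))

Σ<-zero : ∀ M → Σ< M (λ _ → 0ℤ) ≡ 0ℤ
Σ<-zero zero    = ≡.refl
Σ<-zero (suc M) = ≡.trans (ℤ.+-identityˡ _) (Σ<-zero M)

-- The guard is what `p ≤ᵇ b` in `gen` becomes for `p = suc t`; raising the bound admits the single
-- new largest part `suc b`.
Σ<-extend : ∀ M b (c : ℕ → ℤ) → Σ< M (λ t → if t <ᵇ suc b then c t else 0ℤ)
                    ≡ Σ< M (λ t → if t <ᵇ b then c t else 0ℤ) ℤ.+ (if b <ᵇ M then c b else 0ℤ)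
Σ<-extend zero    b       c = ≡.refl
Σ<-extend (suc M) zero    c = begin
  c 0 ℤ.+ Σ< M (λ _ → 0ℤ)            ≡⟨ cong (ℤ._+_ (c 0)) (Σ<-zero M) ⟩
  c 0 ℤ.+ 0ℤ                         ≡⟨ ℤ.+-comm (c 0) 0ℤ ⟩
  0ℤ ℤ.+ c 0                         ≡⟨ cong (ℤ._+ c 0) (≡.trans (ℤ.+-identityˡ _) (Σ<-zero M)) ⟨
  0ℤ ℤ.+ Σ< M (λ _ → 0ℤ) ℤ.+ c 0     ∎
  where open ≡.≡-Reasoning
Σ<-extend (suc M) (suc b) c = ≡.trans (cong (ℤ._+_ (c 0)) (Σ<-extend M b (c ∘ suc)))
  (≡.sym (ℤ.+-assoc (c 0) (Σ< M (λ t → if t <ᵇ b then c (suc t) else 0ℤ)) _))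

-- Partitions with bounded parts

-- Positivity is built in by writing a part as `suc t`, and weak decrease by bounding the tail by
-- the head.
data Parts (b : ℕ) : ℕ → List ℕ → Set where
  []   : Parts b 0 []
  cons : ∀ {t m l} → t < b → Parts (suc t) m l → Parts b (suc t ℕ.+ m) (suc t ∷ l)

<ᵇ-true : ∀ {m n} → m < n → (m <ᵇ n) ≡ true
<ᵇ-true m<n = Equivalence.to T-≡ (ℕ.<⇒<ᵇ m<n)

<ᵇ-true⁻¹ : ∀ {m n} → (m <ᵇ n) ≡ true → m < n
<ᵇ-true⁻¹ {m} {n} e = ℕ.<ᵇ⇒< m n (Equivalence.from T-≡ e)

<ᵇ-false : ∀ {m n} → n ≤ m → (m <ᵇ n) ≡ false
<ᵇ-false {n = zero}          _         = ≡.refl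
<ᵇ-false {suc m} {n = suc n} (s≤s n≤m) = <ᵇ-false n≤m

gen-sound : ∀ f m b → All (Parts b m) (gen f m b)
gen-sound f       zero    b = [] ∷ []
gen-sound zero    (suc m) b = []
gen-sound (suc f) (suc m) b = All.concat⁺ (All.map⁺ (All.map⁺ (All.applyUpTo⁺₁ id (suc m) block)))
  where
  block : ∀ {t} → t < suc m →
          All (Parts b (suc m)) (if t <ᵇ b then map (suc t ∷_) (gen f (m ∸ t) (suc t)) else [])
  block {t} (s≤s t≤m) with t <ᵇ b in t<b
  ... | false = []
  ... | true  = All.map⁺ (All.map
    (λ {l} r → ≡.subst (λ n → Parts b n (suc t ∷ l)) (cong suc (ℕ.m+[n∸m]≡n t≤m)) (cons (<ᵇ-true⁻¹ t<b) r))
    (gen-sound f (m ∸ t) (suc t)))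

sumOver-gen : ∀ F f m b → sumOver F (gen (suc f) (suc m) b) ≡
  Σ< (suc m) (λ t → if t <ᵇ b then sumOver (F ∘ (suc t ∷_)) (gen f (m ∸ t) (suc t)) else 0ℤ)
sumOver-gen F f m b = begin
  sumOver F (gen (suc f) (suc m) b)
    ≡⟨ sumOver-concatMap F block (map suc (upTo (suc m))) ⟩
  sumOver (sumOver F ∘ block) (map suc (upTo (suc m)))
    ≡⟨ sumOver-map (sumOver F ∘ block) suc (upTo (suc m)) ⟩
  sumOver (sumOver F ∘ block ∘ suc) (upTo (suc m))
    ≡⟨ sumOver-applyUpTo (sumOver F ∘ block ∘ suc) id (suc m) ⟩
  Σ< (suc m) (λ t → sumOver F (if t <ᵇ b then map (suc t ∷_) (gen f (m ∸ t) (suc t)) else []))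
    ≡⟨ Σ<-cong (suc m) (λ t → push (t <ᵇ b) (suc t) (gen f (m ∸ t) (suc t))) ⟩
  Σ< (suc m) (λ t → if t <ᵇ b then sumOver (F ∘ (suc t ∷_)) (gen f (m ∸ t) (suc t)) else 0ℤ) ∎
  where
  open ≡.≡-Reasoning
  block : ℕ → List (List ℕ)
  block p = if p ≤ᵇ b then map (p ∷_) (gen f (suc m ∸ p) p) else []
  push : ∀ c p ls → sumOver F (if c then map (p ∷_) ls else [])
                  ≡ (if c then sumOver (F ∘ (p ∷_)) ls else 0ℤ)
  push true  p ls = sumOver-map F (p ∷_) ls
  push false p ls = ≡.refl

-- The recursive calls of `gen` carry more fuel than the remaining sum, whereas `Λ` always takes
-- fuel equal to the sum.
sumOver-gen-fuel : ∀ F f f′ m b → m ≤ f → m ≤ f′ → sumOver F (gen f m b) ≡ sumOver F (gen f′ m b)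
sumOver-gen-fuel F f       f′       zero    b _         _          = ≡.refl
sumOver-gen-fuel F (suc f) (suc f′) (suc m) b (s≤s m≤f) (s≤s m≤f′) = begin
  sumOver F (gen (suc f) (suc m) b)  ≡⟨ sumOver-gen F f m b ⟩
  Σ< (suc m) (summand f)             ≡⟨ Σ<-cong (suc m) (λ t → cong (if t <ᵇ b then_else 0ℤ)
                                          (sumOver-gen-fuel (F ∘ (suc t ∷_)) f f′ (m ∸ t) (suc t)
                                            (ℕ.≤-trans (ℕ.m∸n≤m m t) m≤f)
                                            (ℕ.≤-trans (ℕ.m∸n≤m m t) m≤f′))) ⟩
  Σ< (suc m) (summand f′)            ≡⟨ sumOver-gen F f′ m b ⟨
  sumOver F (gen (suc f′) (suc m) b) ∎
  where
  open ≡.≡-Reasoning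
  summand : ℕ → ℕ → ℤ
  summand f t = if t <ᵇ b then sumOver (F ∘ (suc t ∷_)) (gen f (m ∸ t) (suc t)) else 0ℤ

-- The generating function of the partitions with parts at most `b`, each weighted by `f`. The
-- weight is arbitrary because removing a part changes it to `f ∘ (p ∷_)`.
Λ : ℕ → (List ℕ → ℤ) → Series
Λ b f m = sumOver f (gen m m b)

Λ-zero : ∀ f m → Λ 0 f m ≡ const (f []) m
Λ-zero f zero    = ℤ.+-identityʳ (f [])
Λ-zero f (suc m) = ≡.trans (sumOver-gen f m m 0) (Σ<-zero (suc m))

-- Either no part equals `suc b`, or one copy of it is removed; the rest may contain it again, so
-- the bound on the right stays `suc b`.
Λ-step : ∀ b f m → Λ (suc b) f m ≡ Λ b f m ℤ.+ (mono (suc b) ⊛ Λ (suc b) (f ∘ (suc b ∷_))) m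
Λ-step b f zero    = ≡.sym (≡.trans (cong (ℤ._+_ (Λ b f 0)) (mono-⊛ (suc b) (Λ (suc b) (f ∘ (suc b ∷_))) 0))
                                (ℤ.+-identityʳ _))
Λ-step b f (suc m) = begin
  Λ (suc b) f (suc m)
    ≡⟨ sumOver-gen f m m (suc b) ⟩
  Σ< (suc m) (λ t → if t <ᵇ suc b then c t else 0ℤ)
    ≡⟨ Σ<-extend (suc m) b c ⟩
  Σ< (suc m) (λ t → if t <ᵇ b then c t else 0ℤ) ℤ.+ (if b <ᵇ suc m then c b else 0ℤ)
    ≡⟨ cong₂ ℤ._+_ (sumOver-gen f m m b) (cong (if b <ᵇ suc m then_else 0ℤ)
         (sumOver-gen-fuel _ (m ∸ b) m (m ∸ b) (suc b) ℕ.≤-refl (ℕ.m∸n≤m m b))) ⟨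
  Λ b f (suc m) ℤ.+ (if b <ᵇ suc m then Λ (suc b) (f ∘ (suc b ∷_)) (m ∸ b) else 0ℤ)
    ≡⟨ cong (ℤ._+_ (Λ b f (suc m))) (mono-⊛ (suc b) (Λ (suc b) (f ∘ (suc b ∷_))) (suc m)) ⟨
  Λ b f (suc m) ℤ.+ (mono (suc b) ⊛ Λ (suc b) (f ∘ (suc b ∷_))) (suc m) ∎
  where
  open ≡.≡-Reasoning
  c : ℕ → ℤ
  c t = sumOver (f ∘ (suc t ∷_)) (gen m (m ∸ t) (suc t))

Λ-bound : ∀ f {m b} → m ≤ b → Λ b f m ≡ Λ m f m
Λ-bound f {m} m≤b = ≡.subst (λ b → Λ b f m ≡ Λ m f m) (ℕ.m∸n+n≡m m≤b) (go _)
  where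
  go : ∀ t → Λ (t ℕ.+ m) f m ≡ Λ m f m
  go zero    = ≡.refl
  go (suc t) = begin
    Λ (suc (t ℕ.+ m)) f m
      ≡⟨ Λ-step (t ℕ.+ m) f m ⟩
    Λ (t ℕ.+ m) f m ℤ.+ (mono (suc (t ℕ.+ m)) ⊛ Λ _ _) m
      ≡⟨ cong (ℤ._+_ (Λ (t ℕ.+ m) f m)) (≡.trans (mono-⊛ (suc (t ℕ.+ m)) (Λ (suc (t ℕ.+ m)) (f ∘ (suc (t ℕ.+ m) ∷_))) m)
           (cong (if_then Λ (suc (t ℕ.+ m)) (f ∘ (suc (t ℕ.+ m) ∷_)) (m ∸ suc (t ℕ.+ m)) else 0ℤ)
             (<ᵇ-false (ℕ.m≤n+m m t)))) ⟩
    Λ (t ℕ.+ m) f m ℤ.+ 0ℤ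
      ≡⟨ ℤ.+-identityʳ _ ⟩
    Λ (t ℕ.+ m) f m
      ≡⟨ go t ⟩
    Λ m f m ∎
    where open ≡.≡-Reasoning

Parts-isPartitionOf : ∀ {b m l} → Parts b m l → isPartitionOf m l ≡ true
Parts-isPartitionOf r = cong₂ _∧_ (pos r) (cong₂ _∧_ (decr r) (total r))
  where
  pos : ∀ {b m l} → Parts b m l → allPos l ≡ true
  pos []         = ≡.refl
  pos (cons _ r) = pos r
  decr : ∀ {b m l} → Parts b m l → nonIncr l ≡ true
  decr []                      = ≡.refl
  decr (cons _ [])             = ≡.refl
  decr (cons _ (cons t<b r))   = cong₂ _∧_ (<ᵇ-true t<b) (decr (cons t<b r))
  total : ∀ {b m l} → Parts b m l → (sum l ≡ᵇ m) ≡ true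
  total r = Equivalence.to T-≡ (ℕ.≡⇒≡ᵇ _ _ (sum≡ r))
    where
    sum≡ : ∀ {b m l} → Parts b m l → sum l ≡ m
    sum≡ []               = ≡.refl
    sum≡ (cons {t} _ r) = cong (suc t ℕ.+_) (sum≡ r)

-- Replaces the bound `m` in `partitions m` by one bound valid for all coefficients at once.
sumOver-partitions : ∀ f {m b} → m ≤ b → sumOver f (partitions m) ≡ Λ b f m
sumOver-partitions f {m} m≤b = ≡.trans
  (cong (sumOver f) (filterB-all (All.map Parts-isPartitionOf (gen-sound m m m))))
  (≡.sym (Λ-bound f m≤b))

-- Effect on the tests of adjoining copies of a new largest part

≡ᵇ-refl : ∀ n → (n ≡ᵇ n) ≡ true
≡ᵇ-refl zero    = ≡.refl
≡ᵇ-refl (suc n) = ≡ᵇ-refl n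

<⇒≡ᵇ-false : ∀ {m n} → m < n → (m ≡ᵇ n) ≡ false
<⇒≡ᵇ-false {zero}  (s≤s _)   = ≡.refl
<⇒≡ᵇ-false {suc m} (s≤s m<n) = <⇒≡ᵇ-false m<n

>⇒≡ᵇ-false : ∀ {m n} → m < n → (n ≡ᵇ m) ≡ false
>⇒≡ᵇ-false {zero}  (s≤s _)   = ≡.refl
>⇒≡ᵇ-false {suc m} (s≤s m<n) = >⇒≡ᵇ-false m<n

Parts-≤ : ∀ {b m l} → Parts b m l → All (_≤ b) l
Parts-≤ []           = []
Parts-≤ (cons t<b r) = t<b ∷ All.map (λ y≤t → ℕ.≤-trans y≤t t<b) (Parts-≤ r)

every : (ℕ → Bool) → List ℕ → Bool
every p = foldr (λ x r → p x ∧ r) true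

every-cong : ∀ {p q l} → All (λ x → p x ≡ q x) l → every p l ≡ every q l
every-cong []       = ≡.refl
every-cong (e ∷ es) = cong₂ _∧_ e (every-cong es)

every-replicate : ∀ p c x l → every p (replicate (suc c) x ++ l) ≡ p x ∧ every p l
every-replicate p zero    x l = ≡.refl
every-replicate p (suc c) x l with p x | every-replicate p c x l
... | true  | e = e
... | false | _ = ≡.refl

occ-< : ∀ {y x} c l → y < x → occ y (replicate c x ++ l) ≡ occ y l
occ-< zero    l y<x = ≡.refl
occ-< (suc c) l y<x rewrite <⇒≡ᵇ-false y<x = occ-< c l y<x

occ-absent : ∀ {x l} → All (_< x) l → occ x l ≡ 0
occ-absent []                              = ≡.refl
occ-absent (y<x ∷ ys) rewrite >⇒≡ᵇ-false y<x = occ-absent ys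

occ-replicate : ∀ {x l} c → All (_< x) l → occ x (replicate c x ++ l) ≡ c
occ-replicate zero    l<x = occ-absent l<x
occ-replicate {x} (suc c) l<x rewrite ≡ᵇ-refl x = cong suc (occ-replicate c l<x)

elemB-< : ∀ {y x} c l → y < x → elemB y (replicate c x ++ l) ≡ elemB y l
elemB-< zero    l y<x = ≡.refl
elemB-< (suc c) l y<x rewrite <⇒≡ᵇ-false y<x = elemB-< c l y<x

elemB-absent : ∀ {x l} → All (_< x) l → elemB x l ≡ false
elemB-absent []                                = ≡.refl
elemB-absent (y<x ∷ ys) rewrite >⇒≡ᵇ-false y<x = elemB-absent ys

distinctEven : List ℕ → Bool
distinctEven l = strictDecr l ∧ allEven l

strictDecr-∷ : ∀ {x l} → All (_< x) l → strictDecr (x ∷ l) ≡ strictDecr l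
strictDecr-∷ []                            = ≡.refl
strictDecr-∷ (y<x ∷ _) rewrite <ᵇ-true y<x = ≡.refl

distinctEven-replicate : ∀ {x l} c → All (_< x) l → distinctEven (replicate c x ++ l)
  ≡ (if evenB x then c ≤ᵇ 1 else (c ≡ᵇ 0)) ∧ distinctEven l
distinctEven-replicate {x} zero l<x with evenB x
... | true  = ≡.refl
... | false = ≡.refl
distinctEven-replicate {x} {l} (suc zero) l<x
  rewrite strictDecr-∷ l<x with evenB x
... | true  = ≡.refl
... | false = ∧-zeroʳ (strictDecr l)
distinctEven-replicate {x} (suc (suc c)) l<x rewrite <ᵇ-false (ℕ.≤-refl {x}) with evenB x
... | true  = ≡.refl
... | false = ≡.refl

oddOnce : List ℕ → ℕ → Bool
oddOnce l y = evenB y ∨ (occ y l ≤ᵇ 1)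

distinctOdd : List ℕ → Bool
distinctOdd l = every (oddOnce l) l

-- The parts of `l` are tested against their counts in the whole list, but copies of the larger `x`
-- do not alter those counts.
distinctOdd-replicate : ∀ {x l} c → All (_< x) l →
  distinctOdd (replicate c x ++ l) ≡ (evenB x ∨ (c ≤ᵇ 1)) ∧ distinctOdd l
distinctOdd-replicate {x} {l} zero l<x = cong (_∧ distinctOdd l) (≡.sym (∨-zeroʳ (evenB x)))
distinctOdd-replicate {x} {l} (suc c) l<x = begin
  distinctOdd L
    ≡⟨ every-replicate (oddOnce L) c x l ⟩
  oddOnce L x ∧ every (oddOnce L) l
    ≡⟨ cong₂ (λ n r → (evenB x ∨ (n ≤ᵇ 1)) ∧ r) (occ-replicate (suc c) l<x)
         (every-cong (All.map (λ {y} y<x → cong (λ n → evenB y ∨ (n ≤ᵇ 1)) (occ-< (suc c) l y<x)) l<x)) ⟩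
  (evenB x ∨ (suc c ≤ᵇ 1)) ∧ distinctOdd l ∎
  where
  open ≡.≡-Reasoning
  L = replicate (suc c) x ++ l

firstBig-bounded : ∀ k {x l} → All (_< x) l → 0 < x → firstBig k l < x
firstBig-bounded k []          0<x = 0<x
firstBig-bounded k {l = y ∷ l} (y<x ∷ ys) 0<x with firstBig k l | firstBig-bounded k ys 0<x
... | suc _ | p<x = p<x
... | zero  | _ with (2 ℕ.* k ∸ 1) <ᵇ y
...   | true  = y<x
...   | false = 0<x

firstBig-none : ∀ k {l} → All (_≤ 2 ℕ.* k ∸ 1) l → firstBig k l ≡ 0
firstBig-none k []         = ≡.refl
firstBig-none k {y ∷ l} (p ∷ ps) rewrite firstBig-none k ps | <ᵇ-false p = ≡.refl

firstBig-replicate-some : ∀ k {x p} c l → firstBig k l ≡ suc p → firstBig k (replicate c x ++ l) ≡ suc p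
firstBig-replicate-some k zero    l e = e
firstBig-replicate-some k {x} (suc c) l e rewrite firstBig-replicate-some k {x} c l e = ≡.refl

firstBig-replicate-none : ∀ k {x} c l → 2 ℕ.* k ∸ 1 < x → firstBig k l ≡ 0 →
                          firstBig k (replicate (suc c) x ++ l) ≡ x
firstBig-replicate-none k zero l big e rewrite e | <ᵇ-true big = ≡.refl
firstBig-replicate-none k {suc x} (suc c) l big e rewrite firstBig-replicate-none k c l big e = ≡.refl

-- Since `firstBig` defaults to 0, this says that odd parts are distinct and no part exceeds 2k-1:
-- what lies below the first big part of an MP partition.
noBig : ℕ → List ℕ → Bool
noBig k l = (firstBig k l ≡ᵇ 0) ∧ distinctOdd l

noBig-replicate : ∀ k {x l} c → 2 ℕ.* k ∸ 1 < x → All (_< x) l →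
                  noBig k (replicate c x ++ l) ≡ (c ≡ᵇ 0) ∧ noBig k l
noBig-replicate k zero    big l<x = ≡.refl
noBig-replicate k {x} {l} (suc c) big l<x with firstBig k l in e
... | suc p rewrite firstBig-replicate-some k {x} (suc c) l e = ≡.refl
... | zero  = cong (_∧ distinctOdd (replicate (suc c) x ++ l))
  (≡.trans (cong (_≡ᵇ 0) (firstBig-replicate-none k c l big e)) (>⇒≡ᵇ-false (ℕ.≤-<-trans z≤n big)))

mpTest : ℕ → List ℕ → ℕ → Bool
mpTest p l y = (y ≡ᵇ p) ∨ oddOnce l y

every-mpTest : ∀ p {x l} c → All (_< x) l →
  every (mpTest p (replicate c x ++ l)) (replicate c x ++ l)
  ≡ ((x ≡ᵇ p) ∨ evenB x ∨ (c ≤ᵇ 1)) ∧ every (mpTest p l) l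
every-mpTest p {x} {l} zero l<x = cong (_∧ every (mpTest p l) l)
  (≡.sym (≡.trans (cong ((x ≡ᵇ p) ∨_) (∨-zeroʳ (evenB x))) (∨-zeroʳ (x ≡ᵇ p))))
every-mpTest p {x} {l} (suc c) l<x = begin
  every (mpTest p L) L
    ≡⟨ every-replicate (mpTest p L) c x l ⟩
  mpTest p L x ∧ every (mpTest p L) l
    ≡⟨ cong₂ (λ n r → ((x ≡ᵇ p) ∨ evenB x ∨ (n ≤ᵇ 1)) ∧ r) (occ-replicate (suc c) l<x)
         (every-cong (All.map (λ {y} y<x → cong (λ n → (y ≡ᵇ p) ∨ evenB y ∨ (n ≤ᵇ 1))
                                                (occ-< (suc c) l y<x)) l<x)) ⟩
  ((x ≡ᵇ p) ∨ evenB x ∨ (suc c ≤ᵇ 1)) ∧ every (mpTest p l) l ∎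
  where
  open ≡.≡-Reasoning
  L = replicate (suc c) x ++ l

-- `isMP k l` is `mp k (firstBig k l) l` by definition; making the first big part an argument allows
-- its value to be rewritten.
mp : ℕ → ℕ → List ℕ → Bool
mp k p l = (1 ≤ᵇ p) ∧ not (evenB p) ∧ (occ p l ≡ᵇ k) ∧ every (mpTest p l) l

isMP-some : ∀ k {x l p} c → All (_< x) l → suc p < x → firstBig k l ≡ suc p →
            isMP k (replicate c x ++ l) ≡ (evenB x ∨ (c ≤ᵇ 1)) ∧ isMP k l
isMP-some k {x} {l} {p} c l<x p<x e = begin
  mp k (firstBig k L) L
    ≡⟨ cong (λ p → mp k p L) (firstBig-replicate-some k c l e) ⟩
  mp k (suc p) L
    ≡⟨ cong₂ (λ n r → not (evenB (suc p)) ∧ (n ≡ᵇ k) ∧ r) (occ-< c l p<x) (every-mpTest (suc p) c l<x) ⟩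
  o ∧ t ∧ (((x ≡ᵇ suc p) ∨ w) ∧ r)
    ≡⟨ cong (λ v → o ∧ t ∧ ((v ∨ w) ∧ r)) (>⇒≡ᵇ-false p<x) ⟩
  o ∧ t ∧ (w ∧ r)
    ≡⟨ pull w ⟩
  w ∧ mp k (suc p) l
    ≡⟨ cong (λ p → w ∧ mp k p l) e ⟨
  w ∧ mp k (firstBig k l) l ∎
  where
  open ≡.≡-Reasoning
  L = replicate c x ++ l
  o = not (evenB (suc p))
  t = occ (suc p) l ≡ᵇ k
  w = evenB x ∨ (c ≤ᵇ 1)
  r = every (mpTest (suc p) l) l
  pull : ∀ w → o ∧ t ∧ (w ∧ r) ≡ w ∧ (o ∧ t ∧ r)
  pull true  = ≡.refl
  pull false = ≡.trans (cong (o ∧_) (∧-zeroʳ t)) (∧-zeroʳ o)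

isMP-none : ∀ k {x l} c → All (_< x) l → 2 ℕ.* k ∸ 1 < x → firstBig k l ≡ 0 →
            isMP k (replicate (suc c) x ++ l) ≡ not (evenB x) ∧ (suc c ≡ᵇ k) ∧ distinctOdd l
isMP-none k {suc x} {l} c l<x big e = begin
  mp k (firstBig k L) L
    ≡⟨ cong (λ p → mp k p L) (firstBig-replicate-none k c l big e) ⟩
  mp k (suc x) L
    ≡⟨ cong₂ (λ n r → not (evenB (suc x)) ∧ (n ≡ᵇ k) ∧ r) (occ-replicate (suc c) l<x)
         (≡.trans (every-mpTest (suc x) (suc c) l<x)
           (cong₂ (λ v r → (v ∨ evenB (suc x) ∨ (suc c ≤ᵇ 1)) ∧ r) (≡ᵇ-refl x)
             (every-cong (All.map (λ {y} y<x → cong (_∨ oddOnce l y) (<⇒≡ᵇ-false y<x)) l<x)))) ⟩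
  not (evenB (suc x)) ∧ (suc c ≡ᵇ k) ∧ distinctOdd l ∎
  where
  open ≡.≡-Reasoning
  L = replicate (suc c) (suc x) ++ l

-- Copies of x either leave the smallest big part of l in place, or become it
-- when l has no big part.
isMP-replicate : ∀ k {x l} c → 2 ℕ.* suc k ∸ 1 < x → All (_< x) l →
  ⟦ isMP (suc k) (replicate c x ++ l) ⟧
  ≡ ⟦ evenB x ∨ (c ≤ᵇ 1) ⟧ ℤ.* ⟦ isMP (suc k) l ⟧
    ℤ.+ ⟦ not (evenB x) ∧ (c ≡ᵇ suc k) ⟧ ℤ.* ⟦ noBig (suc k) l ⟧
isMP-replicate k {x} {l} c big l<x = split (firstBig (suc k) l) ≡.refl
  where
  open ≡.≡-Reasoning
  a e : Bool
  a = evenB x ∨ (c ≤ᵇ 1)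
  e = not (evenB x) ∧ (c ≡ᵇ suc k)
  split : ∀ p → firstBig (suc k) l ≡ p → ⟦ isMP (suc k) (replicate c x ++ l) ⟧
          ≡ ⟦ a ⟧ ℤ.* ⟦ isMP (suc k) l ⟧ ℤ.+ ⟦ e ⟧ ℤ.* ⟦ noBig (suc k) l ⟧
  split (suc p) fb = begin
    ⟦ isMP (suc k) (replicate c x ++ l) ⟧
      ≡⟨ cong ⟦_⟧ (isMP-some (suc k) c l<x
           (≡.subst (_< x) fb (firstBig-bounded (suc k) l<x (ℕ.≤-<-trans z≤n big))) fb) ⟩
    ⟦ a ∧ isMP (suc k) l ⟧
      ≡⟨ ⟦∧⟧ a (isMP (suc k) l) ⟩
    ⟦ a ⟧ ℤ.* ⟦ isMP (suc k) l ⟧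
      ≡⟨ ℤ.+-identityʳ _ ⟨
    ⟦ a ⟧ ℤ.* ⟦ isMP (suc k) l ⟧ ℤ.+ 0ℤ
      ≡⟨ cong (ℤ._+_ (⟦ a ⟧ ℤ.* ⟦ isMP (suc k) l ⟧)) (ℤ.*-zeroʳ ⟦ e ⟧) ⟨
    ⟦ a ⟧ ℤ.* ⟦ isMP (suc k) l ⟧ ℤ.+ ⟦ e ⟧ ℤ.* 0ℤ
      ≡⟨ cong (λ p → ⟦ a ⟧ ℤ.* ⟦ isMP (suc k) l ⟧ ℤ.+ ⟦ e ⟧ ℤ.* ⟦ (p ≡ᵇ 0) ∧ distinctOdd l ⟧) fb ⟨
    ⟦ a ⟧ ℤ.* ⟦ isMP (suc k) l ⟧ ℤ.+ ⟦ e ⟧ ℤ.* ⟦ noBig (suc k) l ⟧ ∎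
  split zero fb = begin
    ⟦ isMP (suc k) (replicate c x ++ l) ⟧
      ≡⟨ cong ⟦_⟧ (none c) ⟩
    ⟦ e ∧ distinctOdd l ⟧
      ≡⟨ ⟦∧⟧ e (distinctOdd l) ⟩
    ⟦ e ⟧ ℤ.* ⟦ distinctOdd l ⟧
      ≡⟨ ℤ.+-identityˡ _ ⟨
    0ℤ ℤ.+ ⟦ e ⟧ ℤ.* ⟦ distinctOdd l ⟧
      ≡⟨ cong (ℤ._+ (⟦ e ⟧ ℤ.* ⟦ distinctOdd l ⟧)) (ℤ.*-zeroʳ ⟦ a ⟧) ⟨
    ⟦ a ⟧ ℤ.* 0ℤ ℤ.+ ⟦ e ⟧ ℤ.* ⟦ distinctOdd l ⟧
      ≡⟨ cong (λ p → ⟦ a ⟧ ℤ.* ⟦ mp (suc k) p l ⟧ ℤ.+ ⟦ e ⟧ ℤ.* ⟦ (p ≡ᵇ 0) ∧ distinctOdd l ⟧) fb ⟨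
    ⟦ a ⟧ ℤ.* ⟦ isMP (suc k) l ⟧ ℤ.+ ⟦ e ⟧ ℤ.* ⟦ noBig (suc k) l ⟧ ∎
    where
    none : ∀ c → isMP (suc k) (replicate c x ++ l) ≡ (not (evenB x) ∧ (c ≡ᵇ suc k)) ∧ distinctOdd l
    none zero    = ≡.trans (cong (λ p → mp (suc k) p l) fb)
      (≡.sym (cong (_∧ distinctOdd l) (∧-zeroʳ (not (evenB x)))))
    none (suc c) = ≡.trans (isMP-none (suc k) c l<x big fb) (≡.sym (∧-assoc (not (evenB x)) _ _))

-- Recurrences for the generating functions

module GeneratingFunctions (N : ℕ) where

  open Truncated N hiding (_≈_; ⊛-cong)
  open CommutativeRing ring using
    ( _≈_; refl; sym; trans; setoid; +-cong; +-congˡ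
    ; +-identityˡ; +-identityʳ; zeroˡ; zeroʳ; *-congˡ; *-congʳ; *-assoc; *-identityˡ )
  open import Relation.Binary.Reasoning.Setoid setoid

  const-morphism : ℤ.+-*-rawRing -Raw-AlmostCommutative⟶ fromCommutativeRing ring
  const-morphism = record
    { ⟦_⟧    = const
    ; +-homo = λ a b → pointwise-⊕ λ { zero → ≡.refl ; (suc m) → ≡.refl }
    ; *-homo = λ a b → pointwise λ m → ≡.sym (≡.trans (const-⊛ a (const b) m) (scale a b m))
    ; -‿homo = λ a → pointwise-⊖ λ { zero → ≡.refl ; (suc m) → ≡.refl }
    ; 0-homo = pointwise λ { zero → ≡.refl ; (suc m) → ≡.refl }
    ; 1-homo = refl
    }
    where
    scale : ∀ a b m → a ℤ.* const b m ≡ const (a ℤ.* b) m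
    scale a b zero    = ≡.refl
    scale a b (suc m) = ℤ.*-zeroʳ a

  open _-Raw-AlmostCommutative⟶_ const-morphism using (0-homo)
  open QSeries ring const-morphism mono refl (λ i j → pointwise (mono-+ i j)) public

  vanish : ∀ t → N < t → mono t ≈ 0ˢ
  vanish t N<t = agree λ m m≤N → mono-vanish t m (ℕ.≤-<-trans m≤N N<t)

  -- Σ_c a(c) q^(xc), cut off after C terms.
  multiplicity : ℕ → ℕ → (ℕ → ℤ) → Series
  multiplicity x zero    a = 0ˢ
  multiplicity x (suc C) a = const (a 0) ⊕ mono x ⊛ multiplicity x C (a ∘ suc)

  multiplicity-zero : ∀ x C → multiplicity x C (λ _ → 0ℤ) ≈ 0ˢ
  multiplicity-zero x zero    = refl
  multiplicity-zero x (suc C) = trans (+-cong 0-homo (trans (*-congˡ (multiplicity-zero x C)) (zeroʳ (mono x))))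
    (+-identityˡ 0ˢ)

  multiplicity-at : ∀ x {C k} → k < C → multiplicity x C (λ c → ⟦ c ≡ᵇ k ⟧) ≈ mono (k ℕ.* x)
  multiplicity-at x {suc C} {zero}  _         =
    trans (+-congˡ (trans (*-congˡ (multiplicity-zero x C)) (zeroʳ (mono x)))) (+-identityʳ (const 1ℤ))
  multiplicity-at x {suc C} {suc k} (s≤s k<C) =
    trans (+-cong 0-homo (trans (*-congˡ (multiplicity-at x k<C)) (sym (pointwise (mono-+ x (k ℕ.* x))))))
      (+-identityˡ (mono (suc k ℕ.* x)))

  multiplicity-≤1 : ∀ x C → multiplicity x (suc (suc C)) (λ c → ⟦ c ≤ᵇ 1 ⟧) ≈ const 1ℤ ⊕ mono x
  multiplicity-≤1 x C = +-congˡ (trans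
    (*-congˡ (trans (+-congˡ (trans (*-congˡ (multiplicity-zero x C)) (zeroʳ (mono x)))) (+-identityʳ (const 1ℤ))))
    (solve 1 (λ x → x :* :1 := x) refl (mono x)))

  multiplicity-any : ∀ x C → (const 1ℤ ⊕ ⊖ mono x) ⊛ multiplicity x C (λ _ → 1ℤ)
                             ≈ const 1ℤ ⊕ ⊖ mono (C ℕ.* x)
  multiplicity-any x zero    = trans (zeroʳ (const 1ℤ ⊕ ⊖ mono x)) (sym (CommutativeRing.-‿inverseʳ ring (const 1ℤ)))
  multiplicity-any x (suc C) = begin
    (const 1ℤ ⊕ ⊖ mono x) ⊛ (const 1ℤ ⊕ mono x ⊛ S)
      ≈⟨ solve 2 (λ x s → (:1 :- x) :* (:1 :+ x :* s) := :1 :- x :+ x :* ((:1 :- x) :* s)) refl (mono x) S ⟩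
    const 1ℤ ⊕ ⊖ mono x ⊕ mono x ⊛ ((const 1ℤ ⊕ ⊖ mono x) ⊛ S)
      ≈⟨ +-congˡ (*-congˡ (multiplicity-any x C)) ⟩
    const 1ℤ ⊕ ⊖ mono x ⊕ mono x ⊛ (const 1ℤ ⊕ ⊖ mono (C ℕ.* x))
      ≈⟨ solve 2 (λ x y → :1 :- x :+ x :* (:1 :- y) := :1 :- x :* y) refl (mono x) (mono (C ℕ.* x)) ⟩
    const 1ℤ ⊕ ⊖ (mono x ⊛ mono (C ℕ.* x))
      ≈⟨ +-congˡ (CommutativeRing.-‿cong ring (pointwise (mono-+ x (C ℕ.* x)))) ⟨
    const 1ℤ ⊕ ⊖ mono (suc C ℕ.* x) ∎
    where S = multiplicity x C (λ _ → 1ℤ)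

  -- Above `N`, so that powers past the cutoff vanish, and at least two, so that multiplicities 0
  -- and 1 are both seen.
  fuel : ℕ
  fuel = suc (suc N)

  geometric : ℕ → Series
  geometric x = multiplicity x fuel (λ _ → 1ℤ)

  large : ∀ {C} x → N < C → N < C ℕ.* suc x
  large {C} x N<C = ℕ.≤-trans N<C (ℕ.m≤m*n C (suc x))

  geometric-inverse : ∀ x → (const 1ℤ ⊕ ⊖ mono (suc x)) invertibleBy geometric (suc x)
  geometric-inverse x = begin
    (const 1ℤ ⊕ ⊖ mono (suc x)) ⊛ geometric (suc x)
      ≈⟨ multiplicity-any (suc x) fuel ⟩
    const 1ℤ ⊕ ⊖ mono (fuel ℕ.* suc x)
      ≈⟨ +-congˡ (CommutativeRing.-‿cong ring (trans (vanish _ (large {fuel} x (s≤s (ℕ.n≤1+n N)))) (sym 0-homo))) ⟩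
    const 1ℤ ⊕ ⊖ const 0ℤ
      ≈⟨ solve 0 (:1 :- con 0ℤ := :1) refl ⟩
    const 1ℤ ∎

  Λ-cong : ∀ {b f g} → (∀ {m l} → Parts b m l → m ≤ N → f l ≡ g l) → Λ b f ≈ Λ b g
  Λ-cong p = agree λ m m≤N → sumOver-cong (All.map (λ r → p r m≤N) (gen-sound m m _))

  Λ-vanish : ∀ {b f} → (∀ {m l} → Parts b m l → f l ≡ 0ℤ) → Λ b f ≈ 0ˢ
  Λ-vanish {b} p = trans (Λ-cong (λ r _ → p r)) (pointwise λ m → sumOver-* 0ℤ (λ _ → 0ℤ) (gen m m b))

  -- Sorts partitions by the number of copies of `suc x`; having `C` or more copies costs a power of
  -- q beyond q^N. Two products are allowed because the recursion for `isMP` has two cases.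
  Λ-split : ∀ {x f a e u v} C → N < C →
    (∀ c {l} → All (_< suc x) l → f (replicate c (suc x) ++ l) ≡ a c ℤ.* u l ℤ.+ e c ℤ.* v l) →
    Λ (suc x) f ≈ multiplicity (suc x) C a ⊛ Λ x u ⊕ multiplicity (suc x) C e ⊛ Λ x v
  Λ-split {x} {f} {a} {e} {u} {v} C N<C p = begin
    Λ (suc x) f
      ≈⟨ go C f a e p ⟩
    multiplicity (suc x) C a ⊛ Λ x u ⊕ multiplicity (suc x) C e ⊛ Λ x v ⊕ mono (C ℕ.* suc x) ⊛ rest C f
      ≈⟨ +-congˡ (trans (*-congʳ (vanish _ (large x N<C))) (zeroˡ (rest C f))) ⟩
    multiplicity (suc x) C a ⊛ Λ x u ⊕ multiplicity (suc x) C e ⊛ Λ x v ⊕ 0ˢ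
      ≈⟨ +-identityʳ _ ⟩
    multiplicity (suc x) C a ⊛ Λ x u ⊕ multiplicity (suc x) C e ⊛ Λ x v ∎
    where
    rest : ℕ → (List ℕ → ℤ) → Series
    rest C f = Λ (suc x) (λ l → f (replicate C (suc x) ++ l))
    -- An exact form without the bound on `C`: `rest C f` collects the partitions with at least `C`
    -- copies of `suc x`.
    go : ∀ C f a e →
      (∀ c {l} → All (_< suc x) l → f (replicate c (suc x) ++ l) ≡ a c ℤ.* u l ℤ.+ e c ℤ.* v l) →
      Λ (suc x) f ≈ multiplicity (suc x) C a ⊛ Λ x u ⊕ multiplicity (suc x) C e ⊛ Λ x v
                    ⊕ mono (C ℕ.* suc x) ⊛ rest C f
    go zero f a e p = sym (trans (+-cong
      (trans (+-cong (zeroˡ (Λ x u)) (zeroˡ (Λ x v))) (+-identityˡ 0ˢ))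
      (*-identityˡ (Λ (suc x) f))) (+-identityˡ (Λ (suc x) f)))
    go (suc C) f a e p = begin
      Λ (suc x) f
        ≈⟨ pointwise-⊕ (Λ-step x f) ⟩
      Λ x f ⊕ mono (suc x) ⊛ Λ (suc x) (f ∘ (suc x ∷_))
        ≈⟨ +-cong first (*-congˡ (go C (f ∘ (suc x ∷_)) (a ∘ suc) (e ∘ suc) (p ∘ suc))) ⟩
      const (a 0) ⊛ Λ x u ⊕ const (e 0) ⊛ Λ x v
        ⊕ mono (suc x) ⊛ (A ⊛ Λ x u ⊕ E ⊛ Λ x v ⊕ mono (C ℕ.* suc x) ⊛ rest (suc C) f)
        ≈⟨ solve 9 (λ a₀ e₀ u v z a e y r → a₀ :* u :+ e₀ :* v :+ z :* (a :* u :+ e :* v :+ y :* r)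
                    := (a₀ :+ z :* a) :* u :+ (e₀ :+ z :* e) :* v :+ z :* y :* r) refl
             (const (a 0)) (const (e 0)) (Λ x u) (Λ x v) (mono (suc x)) A E (mono (C ℕ.* suc x)) (rest (suc C) f) ⟩
      (const (a 0) ⊕ mono (suc x) ⊛ A) ⊛ Λ x u ⊕ (const (e 0) ⊕ mono (suc x) ⊛ E) ⊛ Λ x v
        ⊕ mono (suc x) ⊛ mono (C ℕ.* suc x) ⊛ rest (suc C) f
        ≈⟨ +-congˡ (*-congʳ (pointwise (mono-+ (suc x) (C ℕ.* suc x)))) ⟨
      multiplicity (suc x) (suc C) a ⊛ Λ x u ⊕ multiplicity (suc x) (suc C) e ⊛ Λ x v
        ⊕ mono (suc C ℕ.* suc x) ⊛ rest (suc C) f ∎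
      where
      A = multiplicity (suc x) C (a ∘ suc)
      E = multiplicity (suc x) C (e ∘ suc)
      first : Λ x f ≈ const (a 0) ⊛ Λ x u ⊕ const (e 0) ⊛ Λ x v
      first = trans (Λ-cong (λ r _ → p 0 (All.map s≤s (Parts-≤ r)))) (pointwise-⊕ λ m → ≡.trans
        (sumOver-+ (λ l → a 0 ℤ.* u l) (λ l → e 0 ℤ.* v l) (gen m m x))
        (cong₂ ℤ._+_ (≡.trans (sumOver-* (a 0) u (gen m m x)) (≡.sym (const-⊛ (a 0) (Λ x u) m)))
                     (≡.trans (sumOver-* (e 0) v (gen m m x)) (≡.sym (const-⊛ (e 0) (Λ x v) m)))))

  Λ-split₁ : ∀ {x f a u} C → N < C →
    (∀ c {l} → All (_< suc x) l → f (replicate c (suc x) ++ l) ≡ a c ℤ.* u l) →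
    Λ (suc x) f ≈ multiplicity (suc x) C a ⊛ Λ x u
  Λ-split₁ {x} {f} {a} {u} C N<C p = begin
    Λ (suc x) f
      ≈⟨ Λ-split C N<C (λ c l<x → ≡.trans (p c l<x) (≡.sym (ℤ.+-identityʳ _))) ⟩
    multiplicity (suc x) C a ⊛ Λ x u ⊕ multiplicity (suc x) C (λ _ → 0ℤ) ⊛ Λ x u
      ≈⟨ +-congˡ (trans (*-congʳ (multiplicity-zero (suc x) C)) (zeroˡ (Λ x u))) ⟩
    multiplicity (suc x) C a ⊛ Λ x u ⊕ 0ˢ
      ≈⟨ +-identityʳ _ ⟩
    multiplicity (suc x) C a ⊛ Λ x u ∎

  Λ-any : ∀ {x f u} →
    (∀ c {l} → All (_< suc x) l → f (replicate c (suc x) ++ l) ≡ u l) →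
    (const 1ℤ ⊕ ⊖ mono (suc x)) ⊛ Λ (suc x) f ≈ Λ x u
  Λ-any {x} {f} {u} p = begin
    d ⊛ Λ (suc x) f
      ≈⟨ *-congˡ (Λ-split₁ {a = λ _ → 1ℤ} fuel (s≤s (ℕ.n≤1+n N))
           (λ c {l} l<x → ≡.trans (p c l<x) (≡.sym (ℤ.*-identityˡ (u l))))) ⟩
    d ⊛ (geometric (suc x) ⊛ Λ x u)
      ≈⟨ *-assoc d (geometric (suc x)) (Λ x u) ⟨
    d ⊛ geometric (suc x) ⊛ Λ x u
      ≈⟨ *-congʳ (geometric-inverse x) ⟩
    const 1ℤ ⊛ Λ x u
      ≈⟨ *-identityˡ (Λ x u) ⟩
    Λ x u ∎
    where d = const 1ℤ ⊕ ⊖ mono (suc x)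

  Λ-once : ∀ {x p q} →
    (∀ c {l} → All (_< suc x) l → p (replicate c (suc x) ++ l) ≡ (c ≤ᵇ 1) ∧ q l) →
    Λ (suc x) (⟦_⟧ ∘ p) ≈ (const 1ℤ ⊕ mono (suc x)) ⊛ Λ x (⟦_⟧ ∘ q)
  Λ-once {x} {p} {q} e = trans
    (Λ-split₁ {a = λ c → ⟦ c ≤ᵇ 1 ⟧} fuel (s≤s (ℕ.n≤1+n N))
      (λ c {l} l<x → ≡.trans (cong ⟦_⟧ (e c l<x)) (⟦∧⟧ (c ≤ᵇ 1) (q l))))
    (*-congʳ (multiplicity-≤1 (suc x) N))

  Λ-none : ∀ {x p q} →
    (∀ c {l} → All (_< suc x) l → p (replicate c (suc x) ++ l) ≡ (c ≡ᵇ 0) ∧ q l) →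
    Λ (suc x) (⟦_⟧ ∘ p) ≈ Λ x (⟦_⟧ ∘ q)
  Λ-none {x} {p} {q} e = trans
    (Λ-split₁ {a = λ c → ⟦ c ≡ᵇ 0 ⟧} fuel (s≤s (ℕ.n≤1+n N))
      (λ c {l} l<x → ≡.trans (cong ⟦_⟧ (e c l<x)) (⟦∧⟧ (c ≡ᵇ 0) (q l))))
    (trans (*-congʳ (multiplicity-at (suc x) {fuel} {0} (s≤s z≤n))) (*-identityˡ (Λ x (⟦_⟧ ∘ q))))

  Λ-empty : ∀ f → Λ 0 f ≈ const (f [])
  Λ-empty f = pointwise (Λ-zero f)

  evenB-double : ∀ m → evenB (double m) ≡ true
  evenB-double zero    = ≡.refl
  evenB-double (suc m) = evenB-double m

  evenB-suc-double : ∀ m → evenB (suc (double m)) ≡ false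
  evenB-suc-double zero    = ≡.refl
  evenB-suc-double (suc m) = evenB-suc-double m

  odds : ℕ → Series
  odds b = Λ b (⟦_⟧ ∘ distinctOdd)

  odds-even : ∀ m → (const 1ℤ ⊕ ⊖ mono (double (suc m))) ⊛ odds (double (suc m)) ≈ odds (suc (double m))
  odds-even m = Λ-any λ c {l} l<x → cong ⟦_⟧ (≡.trans (distinctOdd-replicate c l<x)
    (cong (λ e → (e ∨ (c ≤ᵇ 1)) ∧ distinctOdd l) (evenB-double (suc m))))

  odds-odd : ∀ m → odds (suc (double m)) ≈ (const 1ℤ ⊕ mono (suc (double m))) ⊛ odds (double m)
  odds-odd m = Λ-once λ c {l} l<x → ≡.trans (distinctOdd-replicate c l<x)
    (cong (λ e → (e ∨ (c ≤ᵇ 1)) ∧ distinctOdd l) (evenB-suc-double m))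

  evens : ℕ → Series
  evens b = Λ b (⟦_⟧ ∘ distinctEven)

  evens-step : ∀ m → evens (double (suc m)) ≈ (const 1ℤ ⊕ mono (double (suc m))) ⊛ evens (double m)
  evens-step m = trans
    (Λ-once {p = distinctEven} λ c {l} l<x → ≡.trans (distinctEven-replicate c l<x)
      (cong (λ e → (if e then c ≤ᵇ 1 else (c ≡ᵇ 0)) ∧ distinctEven l) (evenB-double (suc m))))
    (*-congˡ (Λ-none {p = distinctEven} λ c {l} l<x → ≡.trans (distinctEven-replicate c l<x)
      (cong (λ e → (if e then c ≤ᵇ 1 else (c ≡ᵇ 0)) ∧ distinctEven l) (evenB-suc-double m))))

  all : ℕ → Series
  all b = Λ b (λ _ → 1ℤ)

  all-step : ∀ b → (const 1ℤ ⊕ ⊖ mono (suc b)) ⊛ all (suc b) ≈ all b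
  all-step b = Λ-any λ c l<x → ≡.refl

  2k∸1 : ∀ k → 2 ℕ.* suc k ∸ 1 ≡ suc (double k)
  2k∸1 k = ≡.trans (cong (λ e → k ℕ.+ suc e) (ℕ.+-identityʳ k))
    (≡.trans (ℕ.+-suc k k) (cong suc (≡.sym (double≡+ k))))

  double-mono : ∀ {i j} → i ≤ j → double i ≤ double j
  double-mono z≤n       = z≤n
  double-mono (s≤s i≤j) = s≤s (s≤s (double-mono i≤j))

  module _ (k : ℕ) where

    big-even : ∀ {m} → k ≤ m → 2 ℕ.* suc k ∸ 1 < double (suc m)
    big-even k≤m rewrite 2k∸1 k = double-mono (s≤s k≤m)

    big-odd : ∀ {m} → suc k ≤ m → 2 ℕ.* suc k ∸ 1 < suc (double m)
    big-odd k<m rewrite 2k∸1 k = ℕ.m≤n⇒m≤1+n (double-mono k<m)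

    mps nobigs : ℕ → Series
    mps b    = Λ b (⟦_⟧ ∘ isMP (suc k))
    nobigs b = Λ b (⟦_⟧ ∘ noBig (suc k))

    mps-even : ∀ m → k ≤ m → (const 1ℤ ⊕ ⊖ mono (double (suc m))) ⊛ mps (double (suc m)) ≈ mps (suc (double m))
    mps-even m k≤m = Λ-any λ c {l} l<x → ≡.trans (isMP-replicate k c (big-even k≤m) l<x)
      (≡.trans (cong (λ e → ⟦ e ∨ (c ≤ᵇ 1) ⟧ ℤ.* ⟦ isMP (suc k) l ⟧
                            ℤ.+ ⟦ not e ∧ (c ≡ᵇ suc k) ⟧ ℤ.* ⟦ noBig (suc k) l ⟧) (evenB-double (suc m)))
        (≡.trans (ℤ.+-identityʳ _) (ℤ.*-identityˡ _)))

    mps-odd : ∀ m → suc k ≤ m → mps (suc (double m)) ≈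
      (const 1ℤ ⊕ mono (suc (double m))) ⊛ mps (double m) ⊕ mono (suc k ℕ.* suc (double m)) ⊛ nobigs (double m)
    mps-odd m k<m = trans
      (Λ-split {a = λ c → ⟦ c ≤ᵇ 1 ⟧} {e = λ c → ⟦ c ≡ᵇ suc k ⟧} (suc (suc (N ℕ.+ suc k))) (s≤s (ℕ.m≤n⇒m≤1+n (ℕ.m≤m+n N (suc k))))
        λ c {l} l<x → ≡.trans (isMP-replicate k c (big-odd k<m) l<x)
          (cong (λ e → ⟦ e ∨ (c ≤ᵇ 1) ⟧ ℤ.* ⟦ isMP (suc k) l ⟧
                       ℤ.+ ⟦ not e ∧ (c ≡ᵇ suc k) ⟧ ℤ.* ⟦ noBig (suc k) l ⟧) (evenB-suc-double m)))
      (+-cong (*-congʳ (multiplicity-≤1 (suc (double m)) (N ℕ.+ suc k)))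
              (*-congʳ (multiplicity-at (suc (double m)) (s≤s (ℕ.m≤n⇒m≤1+n (ℕ.m≤n+m (suc k) N))))))

    nobigs-stable : ∀ x → 2 ℕ.* suc k ∸ 1 < suc x → nobigs (suc x) ≈ nobigs x
    nobigs-stable x big = Λ-none λ c l<x → noBig-replicate (suc k) c big l<x

    small : ∀ {m l} → Parts (suc (double k)) m l → firstBig (suc k) l ≡ 0
    small {l = l} r = firstBig-none (suc k) (≡.subst (λ b → All (_≤ b) l) (≡.sym (2k∸1 k)) (Parts-≤ r))

    nobigs-small : nobigs (suc (double k)) ≈ odds (suc (double k))
    nobigs-small = Λ-cong λ {_} {l} r _ → cong (λ p → ⟦ (p ≡ᵇ 0) ∧ distinctOdd l ⟧) (small r)

    mps-small : mps (suc (double k)) ≈ 0ˢ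
    mps-small = Λ-vanish λ {_} {l} r → cong (λ p → ⟦ mp (suc k) p l ⟧) (small r)

    -- Parts above 2k+1 are excluded anyway, so the bound may drop to 2k+1; `odds-even` then
    -- expresses the result through an even bound, the only kind that `Telescope` uses.
    nobigs-odds : ∀ m → suc k ≤ m →
      nobigs (double m) ≈ (const 1ℤ ⊕ ⊖ mono (double (suc k))) ⊛ odds (double (suc k))
    nobigs-odds (suc m) (s≤s k≤m) = trans (nobigs-stable (suc (double m)) (big-even k≤m)) (go (ℕ.≤⇒≤′ k≤m))
      where
      go : ∀ {m} → k ℕ.≤′ m → nobigs (suc (double m))
           ≈ (const 1ℤ ⊕ ⊖ mono (double (suc k))) ⊛ odds (double (suc k))
      go (ℕ.≤′-reflexive ≡.refl) = trans nobigs-small (sym (odds-even k))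
      go {suc m} (ℕ.≤′-step k≤m) = trans
        (nobigs-stable (double (suc m)) (big-odd (s≤s (ℕ.≤′⇒≤ k≤m))))
        (trans (nobigs-stable (suc (double m)) (big-even (ℕ.≤′⇒≤ k≤m))) (go k≤m))

    -- The only part available above 2k+1 is 2k+2, which is even and cannot be the first big part.
    mps-init : mps (double (suc k)) ≈ 0ˢ
    mps-init = cancel (geometric-inverse (suc (double k)))
      (trans (mps-even k ℕ.≤-refl) (trans mps-small (sym (zeroʳ _))))

    mps-step : ∀ m → suc k ≤ m → (const 1ℤ ⊕ ⊖ mono (double (suc m))) ⊛ mps (double (suc m)) ≈
      (const 1ℤ ⊕ mono (suc (double m))) ⊛ mps (double m)
      ⊕ mono (suc k ℕ.* suc (double m)) ⊛ ((const 1ℤ ⊕ ⊖ mono (double (suc k))) ⊛ odds (double (suc k)))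
    mps-step m k<m = trans (mps-even m (ℕ.<⇒≤ k<m))
      (trans (mps-odd m k<m) (+-congˡ (*-congˡ (nobigs-odds m k<m))))

-- Triangular numbers, signs and finite sums

tri-suc : ∀ j → tri (suc j) ≡ suc j ℕ.+ tri j
tri-suc j = begin
  (suc j ℕ.* suc (suc j)) ℕ./ 2               ≡⟨ cong (ℕ._/ 2) (expand j) ⟩
  (suc j ℕ.* 2 ℕ.+ j ℕ.* suc j) ℕ./ 2         ≡⟨ ℕ.+-distrib-/-∣ˡ (j ℕ.* suc j) (ℕ.divides (suc j) ≡.refl) ⟩
  (suc j ℕ.* 2) ℕ./ 2 ℕ.+ (j ℕ.* suc j) ℕ./ 2 ≡⟨ cong (ℕ._+ tri j) (ℕ.m*n/n≡m (suc j) 2) ⟩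
  suc j ℕ.+ tri j                             ∎
  where
  open ≡.≡-Reasoning
  expand : ∀ j → suc j ℕ.* suc (suc j) ≡ suc j ℕ.* 2 ℕ.+ j ℕ.* suc j
  expand = solve-∀

tri-double : ∀ k → tri (double k) ≡ k ℕ.* suc (double k)
tri-suc-double : ∀ k → tri (suc (double k)) ≡ suc k ℕ.* suc (double k)

tri-double zero    = ≡.refl
tri-double (suc k) = ≡.trans (tri-suc (suc (double k)))
  (≡.trans (cong (suc (suc (double k)) ℕ.+_) (tri-suc-double k))
    (≡.trans (cong (λ d → suc (suc d) ℕ.+ suc k ℕ.* suc d) (double≡+ k))
      (≡.trans (expand k) (cong (λ d → suc k ℕ.* suc (suc (suc d))) (≡.sym (double≡+ k))))))
  where
  expand : ∀ k → suc (suc (k ℕ.+ k)) ℕ.+ suc k ℕ.* suc (k ℕ.+ k) ≡ suc k ℕ.* suc (suc (suc (k ℕ.+ k)))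
  expand = solve-∀
tri-suc-double k = ≡.trans (tri-suc (double k)) (cong (suc (double k) ℕ.+_) (tri-double k))

sgn-double-+ : ∀ e r → sgn (double e ℕ.+ r) ≡ sgn r
sgn-double-+ zero    r = ≡.refl
sgn-double-+ (suc e) r = ≡.trans (ℤ.neg-involutive _) (sgn-double-+ e r)

-- An odd factor preserves parity. As the triangular numbers at 2k and 2k+1 are k and k+1 times
-- 2k+1, their signs are `sgn k` and `sgn (suc k)`.
sgn-*-odd : ∀ k e → sgn (k ℕ.* suc (double e)) ≡ sgn k
sgn-*-odd zero    e = ≡.refl
sgn-*-odd (suc k) e = cong ℤ.-_ (≡.trans (sgn-double-+ e (k ℕ.* suc (double e))) (sgn-*-odd k e))

sumℤ-cong : ∀ n {c d} → (∀ j → c j ≡ d j) → sumℤ n c ≡ sumℤ n d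
sumℤ-cong zero    p = p 0
sumℤ-cong (suc n) p = cong₂ ℤ._+_ (sumℤ-cong n p) (p (suc n))

Σ<-snoc : ∀ n (c : ℕ → ℤ) → Σ< (suc n) c ≡ Σ< n c ℤ.+ c n
Σ<-snoc zero    c = ≡.trans (ℤ.+-identityʳ (c 0)) (≡.sym (ℤ.+-identityˡ (c 0)))
Σ<-snoc (suc n) c = ≡.trans (cong (ℤ._+_ (c 0)) (Σ<-snoc n (c ∘ suc)))
  (≡.sym (ℤ.+-assoc (c 0) (Σ< n (c ∘ suc)) (c (suc n))))

sumℤ-Σ< : ∀ n c → sumℤ n c ≡ Σ< (suc n) c
sumℤ-Σ< zero    c = ≡.sym (ℤ.+-identityʳ (c 0))
sumℤ-Σ< (suc n) c = ≡.trans (cong (ℤ._+ c (suc n)) (sumℤ-Σ< n c)) (≡.sym (Σ<-snoc (suc n) c))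

sumℤ-cutoff : ∀ {a n c} → a ≤ n → (∀ j → a < j → c j ≡ 0ℤ) → sumℤ n c ≡ sumℤ a c
sumℤ-cutoff {a} {n} {c} a≤n vanishing = go (ℕ.≤⇒≤′ a≤n)
  where
  go : ∀ {n} → a ℕ.≤′ n → sumℤ n c ≡ sumℤ a c
  go (ℕ.≤′-reflexive ≡.refl) = ≡.refl
  go (ℕ.≤′-step a≤n) = ≡.trans (cong₂ ℤ._+_ (go a≤n) (vanishing _ (s≤s (ℕ.≤′⇒≤ a≤n)))) (ℤ.+-identityʳ _)

sumℤ-last : ∀ L {c} → (∀ j → j < L → c j ≡ 0ℤ) → sumℤ L c ≡ c L
sumℤ-last zero    _         = ≡.refl
sumℤ-last (suc L) {c} vanishing = ≡.trans
  (cong (ℤ._+ c (suc L)) (≡.trans (sumℤ-last L (λ j j<L → vanishing j (ℕ.m<n⇒m<1+n j<L))) (vanishing L (ℕ.n<1+n L))))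
  (ℤ.+-identityˡ _)

-- The mex as a sum of indicators

initial : ℕ → List ℕ → Bool
initial zero    l = true
initial (suc j) l = elemB (suc j) l ∧ initial j l

initial-pred : ∀ j l → initial (suc j) l ≡ true → initial j l ≡ true
initial-pred j l e with elemB (suc j) l
... | true = e

initial-≤ : ∀ {i j} l → i ≤ j → initial j l ≡ true → initial i l ≡ true
initial-≤ {i} l i≤j = go (ℕ.≤⇒≤′ i≤j)
  where
  go : ∀ {j} → i ℕ.≤′ j → initial j l ≡ true → initial i l ≡ true
  go (ℕ.≤′-reflexive ≡.refl) e = e
  go {suc j} (ℕ.≤′-step i≤j) e = go i≤j (initial-pred j l e)

initial-false-≤ : ∀ {i j} l → i ≤ j → initial i l ≡ false → initial j l ≡ false
initial-false-≤ {i} {j} l i≤j e with initial j l in e′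
... | false = ≡.refl
... | true  = contradiction (≡.trans (≡.sym e) (initial-≤ l i≤j e′)) λ ()

elemB-index : ∀ x l → elemB x l ≡ true → Σ (Fin (length l)) λ i → lookup l i ≡ x
elemB-index x (y ∷ l) e with x ≡ᵇ y in x≡y
... | true  = Fin.zero , ≡.sym (ℕ.≡ᵇ⇒≡ x y (Equivalence.from T-≡ x≡y))
... | false with elemB-index x l e
...   | i , q = Fin.suc i , q

initial-elem : ∀ {j} l → initial j l ≡ true → (i : Fin j) → elemB (suc (Fin.toℕ i)) l ≡ true
initial-elem l e i = head (Fin.toℕ i) (initial-≤ l (Fin.toℕ<n i) e)
  where
  head : ∀ i → initial (suc i) l ≡ true → elemB (suc i) l ≡ true
  head i e with elemB (suc i) l
  ... | true = ≡.refl

-- Pigeonhole: the parts 1, ..., j sit at distinct positions of `l`.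
initial-length : ∀ j l → initial j l ≡ true → j ≤ length l
initial-length j l e = Fin.injective⇒≤ {f = position} λ {i} {i′} p → Fin.toℕ-injective (ℕ.suc-injective
  (≡.trans (≡.sym (proj₂ (find i))) (≡.trans (cong (lookup l) p) (proj₂ (find i′)))))
  where
  find : (i : Fin j) → Σ (Fin (length l)) λ x → lookup l x ≡ suc (Fin.toℕ i)
  find i = elemB-index _ l (initial-elem l e i)
  position : Fin j → Fin (length l)
  position i = proj₁ (find i)

initial-long : ∀ j l → length l < j → initial j l ≡ false
initial-long j l L<j with initial j l in e
... | false = ≡.refl
... | true  = contradiction (ℕ.≤-trans L<j (initial-length j l e)) ℕ.1+n≰n

sumℤ-initial : ∀ s l → initial s l ≡ true → sumℤ s (λ j → ⟦ initial j l ⟧) ≡ + suc s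
sumℤ-initial zero    l e = ≡.refl
sumℤ-initial (suc s) l e rewrite e | sumℤ-initial s l (initial-pred s l e) = cong +_ (ℕ.+-comm (suc s) 1)

-- The search invariant is that 1, ..., s are parts. When `suc s` is missing, every later indicator
-- is 0, because `initial` is decreasing in its index.
mexFrom-sumℤ : ∀ l f s → initial s l ≡ true → + mexFrom l f (suc s) ≡ sumℤ (s ℕ.+ f) (λ j → ⟦ initial j l ⟧)
mexFrom-sumℤ l zero    s e rewrite ℕ.+-identityʳ s = ≡.sym (sumℤ-initial s l e)
mexFrom-sumℤ l (suc f) s e with elemB (suc s) l in found
... | true  = ≡.trans (mexFrom-sumℤ l f (suc s) (cong₂ _∧_ found e))
  (cong (λ t → sumℤ t (λ j → ⟦ initial j l ⟧)) (≡.sym (ℕ.+-suc s f)))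
... | false = ≡.trans (≡.sym (sumℤ-initial s l e)) (≡.sym (sumℤ-cutoff (ℕ.m≤m+n s (suc f))
  (λ j s<j → cong ⟦_⟧ (initial-false-≤ l s<j (cong (_∧ initial s l) found)))))

-- The range of summation is made the same for all partitions of numbers up to `N`, so that it can
-- be exchanged with the sum over partitions.
mex-sumℤ : ∀ {N} l → length l ≤ N → + mex l ≡ sumℤ N (λ j → ⟦ initial j l ⟧)
mex-sumℤ l L≤N = ≡.trans (mexFrom-sumℤ l (suc (length l)) 0 ≡.refl)
  (≡.trans (sumℤ-cutoff (ℕ.n≤1+n (length l)) long) (≡.sym (sumℤ-cutoff L≤N long)))
  where
  long : ∀ j → length l < j → ⟦ initial j l ⟧ ≡ 0ℤ
  long j L<j = cong ⟦_⟧ (initial-long j l L<j)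

initial-replicate : ∀ {j x} c l → j < x → initial j (replicate c x ++ l) ≡ initial j l
initial-replicate {zero}  c l _   = ≡.refl
initial-replicate {suc j} c l j<x = cong₂ _∧_ (elemB-< c l j<x) (initial-replicate c l (ℕ.<⇒≤ j<x))

-- Staircases

listEqB-length : ∀ l l′ → listEqB l l′ ≡ true → length l ≡ length l′
listEqB-length []      []        e = ≡.refl
listEqB-length (x ∷ l) (y ∷ l′) e with x ≡ᵇ y
... | true = cong suc (listEqB-length l l′ e)

length-staircase : ∀ j → length (staircase j) ≡ j
length-staircase zero    = ≡.refl
length-staircase (suc j) = cong suc (length-staircase j)

listEqB-staircase : ∀ l j → j ≢ length l → listEqB l (staircase j) ≡ false
listEqB-staircase l j j≢L with listEqB l (staircase j) in e
... | false = ≡.refl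
... | true  = contradiction (≡.trans (≡.sym (length-staircase j)) (≡.sym (listEqB-length l (staircase j) e))) j≢L

-- Only `j = length l` can match. This trades a staircase depending on `l` for fixed ones, each
-- contributing a single monomial.
isStaircase-sumℤ : ∀ {N} l → length l ≤ N → ⟦ isStaircase l ⟧ ≡ sumℤ N (λ j → ⟦ listEqB l (staircase j) ⟧)
isStaircase-sumℤ l L≤N = ≡.sym (≡.trans
  (sumℤ-cutoff L≤N (λ j L<j → cong ⟦_⟧ (listEqB-staircase l j (ℕ.>⇒≢ L<j))))
  (sumℤ-last (length l) (λ j j<L → cong ⟦_⟧ (listEqB-staircase l j (ℕ.<⇒≢ j<L)))))

Parts-length : ∀ {b m l} → Parts b m l → length l ≤ m
Parts-length []             = z≤n
Parts-length (cons {t} _ r) = s≤s (ℕ.≤-trans (Parts-length r) (ℕ.m≤n+m _ t))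

Parts-<staircase : ∀ {b m l j} → Parts b m l → b < j → listEqB l (staircase j) ≡ false
Parts-<staircase []                   (s≤s _)   = ≡.refl
Parts-<staircase {l = _ ∷ l} {suc j} (cons t<b _) (s≤s b≤j) =
  cong (_∧ listEqB l (staircase j)) (<⇒≡ᵇ-false (ℕ.<-≤-trans t<b b≤j))

-- Two colours

Σ<-⊛ : ∀ f g m → Σ< (suc m) (λ a → f a ℤ.* g (m ∸ a)) ≡ (f ⊛ g) m
Σ<-⊛ f g zero    = ℤ.+-identityʳ _
Σ<-⊛ f g (suc m) = cong (ℤ._+_ (f 0 ℤ.* g (suc m))) (Σ<-⊛ (f ∘ suc) g m)

sumOver-cartesianProduct : ∀ {A B : Set} (f : A × B → ℤ) p q → (∀ x y → f (x , y) ≡ p x ℤ.* q y) →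
  ∀ xs ys → sumOver f (cartesianProduct xs ys) ≡ sumOver p xs ℤ.* sumOver q ys
sumOver-cartesianProduct f p q e []       ys = ≡.sym (ℤ.*-zeroˡ (sumOver q ys))
sumOver-cartesianProduct f p q e (x ∷ xs) ys = begin
  sumOver f (map (x ,_) ys ++ cartesianProduct xs ys)
    ≡⟨ sumOver-++ f (map (x ,_) ys) (cartesianProduct xs ys) ⟩
  sumOver f (map (x ,_) ys) ℤ.+ sumOver f (cartesianProduct xs ys)
    ≡⟨ cong₂ ℤ._+_ row (sumOver-cartesianProduct f p q e xs ys) ⟩
  p x ℤ.* sumOver q ys ℤ.+ sumOver p xs ℤ.* sumOver q ys
    ≡⟨ ℤ.*-distribʳ-+ (sumOver q ys) (p x) (sumOver p xs) ⟨
  (p x ℤ.+ sumOver p xs) ℤ.* sumOver q ys ∎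
  where
  open ≡.≡-Reasoning
  row : sumOver f (map (x ,_) ys) ≡ p x ℤ.* sumOver q ys
  row = ≡.trans (sumOver-map f (x ,_) ys)
    (≡.trans (sumOver-cong (All.universal (e x) ys)) (sumOver-* (p x) q ys))

-- `isD2` is by definition a conjunction of one test per colour, so the sum over pairs factors.
D2*-⊛ : ∀ m → + D2* m ≡ ((λ a → + count isStaircase (partitions a)) ⊛ (λ a → + count distinctEven (partitions a))) m
D2*-⊛ m = begin
  + D2* m
    ≡⟨ count-sumOver isD2 (partitionPairs m) ⟩
  sumOver (⟦_⟧ ∘ isD2) (partitionPairs m)
    ≡⟨ sumOver-concatMap (⟦_⟧ ∘ isD2) pairs (upTo (suc m)) ⟩
  sumOver (sumOver (⟦_⟧ ∘ isD2) ∘ pairs) (upTo (suc m))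
    ≡⟨ sumOver-applyUpTo (sumOver (⟦_⟧ ∘ isD2) ∘ pairs) id (suc m) ⟩
  Σ< (suc m) (sumOver (⟦_⟧ ∘ isD2) ∘ pairs)
    ≡⟨ Σ<-cong (suc m) (λ a → ≡.trans
         (sumOver-cartesianProduct (⟦_⟧ ∘ isD2) (⟦_⟧ ∘ isStaircase) (⟦_⟧ ∘ distinctEven)
           (λ l l′ → ⟦∧⟧ (isStaircase l) (distinctEven l′)) (partitions a) (partitions (m ∸ a)))
         (≡.sym (cong₂ ℤ._*_ (count-sumOver isStaircase (partitions a))
                             (count-sumOver distinctEven (partitions (m ∸ a)))))) ⟩
  Σ< (suc m) (λ a → + count isStaircase (partitions a) ℤ.* + count distinctEven (partitions (m ∸ a)))
    ≡⟨ Σ<-⊛ (λ a → + count isStaircase (partitions a)) (λ a → + count distinctEven (partitions a)) m ⟩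
  ((λ a → + count isStaircase (partitions a)) ⊛ (λ a → + count distinctEven (partitions a))) m ∎
  where
  open ≡.≡-Reasoning
  pairs : ℕ → List (List ℕ × List ℕ)
  pairs a = cartesianProduct (partitions a) (partitions (m ∸ a))

-- Assembling the identity

module Assembly (N : ℕ) where

  open Truncated N using (agree; pointwise; pointwise-⊕; pointwise-⊖; at; ring)
  open GeneratingFunctions N
  open CommutativeRing ring using
    ( _≈_; refl; sym; trans; setoid; +-cong; +-congˡ; +-congʳ
    ; +-identityˡ; +-identityʳ; zeroʳ; *-cong; *-congˡ; *-congʳ; *-assoc; *-identityˡ; distribʳ )
  open import Relation.Binary.Reasoning.Setoid setoid

  Σˢ : ℕ → (ℕ → Series) → Series
  Σˢ zero    F = F 0
  Σˢ (suc n) F = Σˢ n F ⊕ F (suc n)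

  Σˢ-at : ∀ n F m → Σˢ n F m ≡ sumℤ n (λ j → F j m)
  Σˢ-at zero    F m = ≡.refl
  Σˢ-at (suc n) F m = ≡.trans (⊕-at (Σˢ n F) (F (suc n)) m) (cong (ℤ._+ F (suc n) m) (Σˢ-at n F m))

  Σˢ-cong : ∀ n {F G} → (∀ j → j ≤ n → F j ≈ G j) → Σˢ n F ≈ Σˢ n G
  Σˢ-cong zero    p = p 0 z≤n
  Σˢ-cong (suc n) p = +-cong (Σˢ-cong n (λ j j≤n → p j (ℕ.m≤n⇒m≤1+n j≤n))) (p (suc n) ℕ.≤-refl)

  Σˢ-*ʳ : ∀ n F a → Σˢ n (λ j → F j ⊛ a) ≈ Σˢ n F ⊛ a
  Σˢ-*ʳ zero    F a = refl
  Σˢ-*ʳ (suc n) F a = trans (+-congʳ (Σˢ-*ʳ n F a)) (sym (distribʳ a (Σˢ n F) (F (suc n))))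

  Λ-Σ : ∀ b n (F : ℕ → List ℕ → ℤ) → Λ b (λ l → sumℤ n (λ j → F j l)) ≈ Σˢ n (λ j → Λ b (F j))
  Λ-Σ b zero    F = refl
  Λ-Σ b (suc n) F = trans
    (pointwise-⊕ λ m → sumOver-+ (λ l → sumℤ n (λ j → F j l)) (F (suc n)) (gen m m b))
    (+-congʳ (Λ-Σ b n F))

  Λ-peel : ∀ b f → Λ (suc b) f ≈ Λ b f ⊕ mono (suc b) ⊛ Λ (suc b) (f ∘ (suc b ∷_))
  Λ-peel b f = pointwise-⊕ (Λ-step b f)

  mono-tri-suc : ∀ j → mono (suc j) ⊛ mono (tri j) ≈ mono (tri (suc j))
  mono-tri-suc j = trans (sym (pointwise (mono-+ (suc j) (tri j))))
    (pointwise λ m → cong (λ t → mono t m) (≡.sym (tri-suc j)))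

  -- Removing one copy of each of 1, ..., j leaves an arbitrary partition. If j is below the largest
  -- allowed part, that part is free on both sides and its factor cancels; otherwise one copy of it
  -- is removed and j drops by one.
  Λ-initial : ∀ b j → j ≤ b → Λ b (⟦_⟧ ∘ initial j) ≈ mono (tri j) ⊛ all b
  Λ-initial b       zero    _ = sym (*-identityˡ (all b))
  Λ-initial (suc b) (suc j) (s≤s j≤b) with ℕ.m≤n⇒m<n∨m≡n j≤b
  ... | inj₁ j<b = cancel (geometric-inverse b) (begin
    d ⊛ Λ (suc b) (⟦_⟧ ∘ initial (suc j))
      ≈⟨ Λ-any (λ c {l} _ → cong ⟦_⟧ (initial-replicate c l (s≤s j<b))) ⟩
    Λ b (⟦_⟧ ∘ initial (suc j))
      ≈⟨ Λ-initial b (suc j) j<b ⟩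
    mono (tri (suc j)) ⊛ all b
      ≈⟨ *-congˡ (all-step b) ⟨
    mono (tri (suc j)) ⊛ (d ⊛ all (suc b))
      ≈⟨ solve 3 (λ t d a → t :* (d :* a) := d :* (t :* a)) refl (mono (tri (suc j))) d (all (suc b)) ⟩
    d ⊛ (mono (tri (suc j)) ⊛ all (suc b)) ∎)
    where d = const 1ℤ ⊕ ⊖ mono (suc b)
  ... | inj₂ ≡.refl = begin
    Λ (suc b) (⟦_⟧ ∘ initial (suc b))
      ≈⟨ Λ-peel b (⟦_⟧ ∘ initial (suc b)) ⟩
    Λ b (⟦_⟧ ∘ initial (suc b)) ⊕ mono (suc b) ⊛ Λ (suc b) (⟦_⟧ ∘ initial (suc b) ∘ (suc b ∷_))
      ≈⟨ +-cong (Λ-vanish λ {_} {l} r → cong (λ e → ⟦ e ∧ initial b l ⟧) (elemB-absent (All.map s≤s (Parts-≤ r))))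
                (*-congˡ (Λ-cong λ {_} {l} _ _ → cong ⟦_⟧ (cong₂ _∧_ (cong (_∨ elemB (suc b) l) (≡ᵇ-refl b))
                                                  (initial-replicate 1 l (ℕ.n<1+n b))))) ⟩
    0ˢ ⊕ mono (suc b) ⊛ Λ (suc b) (⟦_⟧ ∘ initial b)
      ≈⟨ +-identityˡ _ ⟩
    mono (suc b) ⊛ Λ (suc b) (⟦_⟧ ∘ initial b)
      ≈⟨ *-congˡ (Λ-initial (suc b) b (ℕ.n≤1+n b)) ⟩
    mono (suc b) ⊛ (mono (tri b) ⊛ all (suc b))
      ≈⟨ *-assoc (mono (suc b)) (mono (tri b)) (all (suc b)) ⟨
    mono (suc b) ⊛ mono (tri b) ⊛ all (suc b)
      ≈⟨ *-congʳ (mono-tri-suc b) ⟩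
    mono (tri (suc b)) ⊛ all (suc b) ∎

  Λ-staircase : ∀ b j → j ≤ b → Λ b (λ l → ⟦ listEqB l (staircase j) ⟧) ≈ mono (tri j)
  Λ-staircase zero    zero z≤n = Λ-empty _
  Λ-staircase (suc b) j j≤1+b with ℕ.m≤n⇒m<n∨m≡n j≤1+b
  ... | inj₁ (s≤s j≤b) = begin
    Λ (suc b) (λ l → ⟦ listEqB l (staircase j) ⟧)
      ≈⟨ Λ-peel b _ ⟩
    Λ b (λ l → ⟦ listEqB l (staircase j) ⟧) ⊕ mono (suc b) ⊛ Λ (suc b) (λ l → ⟦ listEqB (suc b ∷ l) (staircase j) ⟧)
      ≈⟨ +-cong (Λ-staircase b j j≤b)
           (trans (*-congˡ (Λ-vanish λ {_} {l} _ → cong ⟦_⟧ (mismatch j≤b l))) (zeroʳ (mono (suc b)))) ⟩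
    mono (tri j) ⊕ 0ˢ
      ≈⟨ +-identityʳ _ ⟩
    mono (tri j) ∎
    where
    mismatch : ∀ {j} → j ≤ b → ∀ l → listEqB (suc b ∷ l) (staircase j) ≡ false
    mismatch {zero}  _   l = ≡.refl
    mismatch {suc j} j<b l = cong (_∧ listEqB l (staircase j)) (>⇒≡ᵇ-false j<b)
  ... | inj₂ ≡.refl = begin
    Λ (suc b) (λ l → ⟦ listEqB l (staircase (suc b)) ⟧)
      ≈⟨ Λ-peel b _ ⟩
    Λ b (λ l → ⟦ listEqB l (staircase (suc b)) ⟧)
      ⊕ mono (suc b) ⊛ Λ (suc b) (λ l → ⟦ listEqB (suc b ∷ l) (staircase (suc b)) ⟧)
      ≈⟨ +-cong (Λ-vanish λ r → cong ⟦_⟧ (Parts-<staircase r (ℕ.n<1+n b)))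
                (*-congˡ (Λ-cong λ {_} {l} _ _ → cong (λ e → ⟦ e ∧ listEqB l (staircase b) ⟧) (≡ᵇ-refl b))) ⟩
    0ˢ ⊕ mono (suc b) ⊛ Λ (suc b) (λ l → ⟦ listEqB l (staircase b) ⟧)
      ≈⟨ +-identityˡ _ ⟩
    mono (suc b) ⊛ Λ (suc b) (λ l → ⟦ listEqB l (staircase b) ⟧)
      ≈⟨ *-congˡ (Λ-staircase (suc b) b (ℕ.n≤1+n b)) ⟩
    mono (suc b) ⊛ mono (tri b)
      ≈⟨ mono-tri-suc b ⟩
    mono (tri (suc b)) ∎

  ψ : Series
  ψ = Σˢ N (mono ∘ tri)

  count-Λ : ∀ p {b} → N ≤ b → (λ m → + count p (partitions m)) ≈ Λ b (⟦_⟧ ∘ p)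
  count-Λ p N≤b = agree λ m m≤N → ≡.trans (count-sumOver p (partitions m))
    (sumOver-partitions (⟦_⟧ ∘ p) (ℕ.≤-trans m≤N N≤b))

  σmex-series : ∀ {b} → N ≤ b → (λ m → + σmex m) ≈ ψ ⊛ all b
  σmex-series {b} N≤b = begin
    (λ m → + σmex m)
      ≈⟨ agree (λ m m≤N → ≡.trans (sum-sumOver mex (partitions m)) (sumOver-partitions (+_ ∘ mex) (ℕ.≤-trans m≤N N≤b))) ⟩
    Λ b (+_ ∘ mex)
      ≈⟨ Λ-cong (λ {_} {l} r m≤N → mex-sumℤ l (ℕ.≤-trans (Parts-length r) m≤N)) ⟩
    Λ b (λ l → sumℤ N (λ j → ⟦ initial j l ⟧))
      ≈⟨ Λ-Σ b N (λ j l → ⟦ initial j l ⟧) ⟩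
    Σˢ N (λ j → Λ b (⟦_⟧ ∘ initial j))
      ≈⟨ Σˢ-cong N (λ j j≤N → Λ-initial b j (ℕ.≤-trans j≤N N≤b)) ⟩
    Σˢ N (λ j → mono (tri j) ⊛ all b)
      ≈⟨ Σˢ-*ʳ N (mono ∘ tri) (all b) ⟩
    ψ ⊛ all b ∎

  D2*-series : ∀ {b} → N ≤ b → (λ m → + D2* m) ≈ ψ ⊛ evens b
  D2*-series {b} N≤b = trans (pointwise D2*-⊛) (*-cong staircases (count-Λ distinctEven N≤b))
    where
    staircases : (λ m → + count isStaircase (partitions m)) ≈ ψ
    staircases = begin
      (λ m → + count isStaircase (partitions m))
        ≈⟨ count-Λ isStaircase N≤b ⟩
      Λ b (⟦_⟧ ∘ isStaircase)
        ≈⟨ Λ-cong (λ {_} {l} r m≤N → isStaircase-sumℤ l (ℕ.≤-trans (Parts-length r) m≤N)) ⟩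
      Λ b (λ l → sumℤ N (λ j → ⟦ listEqB l (staircase j) ⟧))
        ≈⟨ Λ-Σ b N (λ j l → ⟦ listEqB l (staircase j) ⟧) ⟩
      Σˢ N (λ j → Λ b (λ l → ⟦ listEqB l (staircase j) ⟧))
        ≈⟨ Σˢ-cong N (λ j j≤N → Λ-staircase b j (ℕ.≤-trans j≤N N≤b)) ⟩
      ψ ∎

  module _ (k : ℕ) where

    -- Large enough for both `suc k ≤ B` in `θ-truncated` and `N ≤ double B`.
    B : ℕ
    B = suc k ℕ.+ N

    N≤2B : N ≤ double B
    N≤2B = ℕ.≤-trans (ℕ.m≤n+m N (suc k)) (≡.subst (B ≤_) (≡.sym (double≡+ B)) (ℕ.m≤m+n B B))

    open Truncation N B N≤2B vanish geometric geometric-inverse (odds ∘ double) (Λ-empty _)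
      (λ m → trans (odds-even m) (odds-odd m))

    sign : ∀ k → s k ≈ const (sgn k)
    sign zero    = refl
    sign (suc k) = trans (CommutativeRing.-‿cong ring (sign k))
      (sym (_-Raw-AlmostCommutative⟶_.-‿homo const-morphism (sgn k)))

    -- `θ` grows by pairs of terms and `Σˢ` by single ones; `prefix` covers the partial sums that
    -- end at an even index.
    θ-series : ∀ k → θ (suc k) ≈ Σˢ (suc (double k)) (λ j → const (sgn (tri j)) ⊛ mono (tri j))
    θ-series k = begin
      θ k ⊕ s k ⊛ (mono (k ℕ.* suc (double k)) ⊕ ⊖ mono (suc k ℕ.* suc (double k)))
        ≈⟨ solve 4 (λ t s x y → t :+ s :* (x :- y) := t :+ s :* x :+ (:- s) :* y) refl (θ k) (s k) _ _ ⟩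
      θ k ⊕ s k ⊛ mono (k ℕ.* suc (double k)) ⊕ s (suc k) ⊛ mono (suc k ℕ.* suc (double k))
        ≈⟨ +-cong (trans (+-congˡ (term k (double k) (tri-double k) (sgn-*-odd k k))) (prefix k))
                  (term (suc k) (suc (double k)) (tri-suc-double k) (sgn-*-odd (suc k) k)) ⟩
      Σˢ (suc (double k)) (λ j → const (sgn (tri j)) ⊛ mono (tri j)) ∎
      where
      term : ∀ k j {e} → tri j ≡ e → sgn e ≡ sgn k → s k ⊛ mono e ≈ const (sgn (tri j)) ⊛ mono (tri j)
      term k j ≡.refl e = *-congʳ (trans (sign k) (pointwise λ m → cong (λ a → const a m) (≡.sym e)))
      prefix : ∀ k → θ k ⊕ const (sgn (tri (double k))) ⊛ mono (tri (double k))
                   ≈ Σˢ (double k) (λ j → const (sgn (tri j)) ⊛ mono (tri j))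
      prefix zero    = +-identityˡ _
      prefix (suc k) = +-congʳ (θ-series k)

    σ D : Series
    σ m = + σmex m
    D m = + D2* m

    series-identity : s k ⊛ (θ (suc k) ⊛ σ ⊕ ⊖ D) ≈ (λ m → + MP (suc k) m) ⊛ D
    series-identity = assemble _ k
      (trans (+-congˡ (*-congˡ (count-Λ (isMP (suc k)) N≤2B)))
        (θ-truncated M mps-step mps-init k (ℕ.m≤m+n (suc k) N)))
      (E*P≈A (evens ∘ double) all (Λ-empty _) evens-step (Λ-empty _) all-step)
      (σmex-series N≤2B) (D2*-series N≤2B)
      where
      -- The index is shifted: `mps k` is the generating function for `MP (suc k)`.
      M : ℕ → ℕ → Series
      M zero    _ = 0ˢ
      M (suc k) m = mps k (double m)

    θ-⊛-at : (θ (suc k) ⊛ σ) N ≡ sumℤ (2 ℕ.* suc k ∸ 1) (λ j → sgn (tri j) ℤ.* σmexSub N (tri j))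
    θ-⊛-at = R.begin
      (θ (suc k) ⊛ σ) N
        R.≡⟨ at (trans (*-congʳ (θ-series k)) (sym (Σˢ-*ʳ (suc (double k)) term σ))) N ℕ.≤-refl ⟩
      Σˢ (suc (double k)) (λ j → term j ⊛ σ) N
        R.≡⟨ Σˢ-at (suc (double k)) (λ j → term j ⊛ σ) N ⟩
      sumℤ (suc (double k)) (λ j → (term j ⊛ σ) N)
        R.≡⟨ sumℤ-cong (suc (double k)) (λ j → ≡.trans (⊛-assoc (const (sgn (tri j))) (mono (tri j)) σ N)
               (≡.trans (const-⊛ (sgn (tri j)) (mono (tri j) ⊛ σ) N)
                        (cong (ℤ._*_ (sgn (tri j))) (mono-⊛ (tri j) σ N)))) ⟩
      sumℤ (suc (double k)) (λ j → sgn (tri j) ℤ.* σmexSub N (tri j))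
        R.≡⟨ cong (λ e → sumℤ e (λ j → sgn (tri j) ℤ.* σmexSub N (tri j))) (2k∸1 k) ⟨
      sumℤ (2 ℕ.* suc k ∸ 1) (λ j → sgn (tri j) ℤ.* σmexSub N (tri j)) R.∎
      where
      module R = ≡.≡-Reasoning
      term : ℕ → Series
      term j = const (sgn (tri j)) ⊛ mono (tri j)

    -- Modulo q^(N+1) the coefficient at `N` is the last one retained, so the truncation order can
    -- be the very n of the theorem.
    coefficient-identity :
      sgn k ℤ.* (sumℤ (2 ℕ.* suc k ∸ 1) (λ j → sgn (tri j) ℤ.* σmexSub N (tri j)) ℤ.- + D2* N)
      ≡ sumℤ N (λ j → + (MP (suc k) j ℕ.* D2* (N ∸ j)))
    coefficient-identity = R.begin
      sgn k ℤ.* (sumℤ (2 ℕ.* suc k ∸ 1) (λ j → sgn (tri j) ℤ.* σmexSub N (tri j)) ℤ.- + D2* N)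
        R.≡⟨ cong (ℤ._*_ (sgn k)) (≡.trans (⊕-at (θ (suc k) ⊛ σ) (⊖ D) N) (cong₂ ℤ._+_ θ-⊛-at (⊖-at D N))) ⟨
      sgn k ℤ.* (θ (suc k) ⊛ σ ⊕ ⊖ D) N
        R.≡⟨ const-⊛ (sgn k) (θ (suc k) ⊛ σ ⊕ ⊖ D) N ⟨
      (const (sgn k) ⊛ (θ (suc k) ⊛ σ ⊕ ⊖ D)) N
        R.≡⟨ at (trans (*-congʳ (sym (sign k))) series-identity) N ℕ.≤-refl ⟩
      ((λ m → + MP (suc k) m) ⊛ D) N
        R.≡⟨ Σ<-⊛ (λ m → + MP (suc k) m) D N ⟨
      Σ< (suc N) (λ j → + MP (suc k) j ℤ.* D (N ∸ j))
        R.≡⟨ Σ<-cong (suc N) (λ j → ℤ.pos-* (MP (suc k) j) (D2* (N ∸ j))) ⟨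
      Σ< (suc N) (λ j → + (MP (suc k) j ℕ.* D2* (N ∸ j)))
        R.≡⟨ sumℤ-Σ< N (λ j → + (MP (suc k) j ℕ.* D2* (N ∸ j))) ⟨
      sumℤ N (λ j → + (MP (suc k) j ℕ.* D2* (N ∸ j))) R.∎
      where module R = ≡.≡-Reasoning

open import Data.Nat using (_*_)
open import Data.Integer using () renaming (_*_ to _*ℤ_; _-_ to _-ℤ_)

theorem6 : (n k : ℕ) → 0 < n → 0 < k →
    sgn (k ∸ 1) *ℤ (sumℤ (2 * k ∸ 1) (λ j → sgn (tri j) *ℤ σmexSub n (tri j)) -ℤ + D2* n)
    ≡ sumℤ n (λ j → + (MP k j * D2* (n ∸ j)))
theorem6 n (suc k) _ _ = Assembly.coefficient-identity n k
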